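{- The permutations $2143$ and $2431$ form an annihilator pair: for every permutation $\tau$ and every pair of distinct indices $i,j\le|\tau|$, the permutation $\tau_{i,j}[2143,2431]$ satisfies $\mu[1,\tau_{i,j}[2143,2431]]=0$.
   Context: Permutations are ordered by containment: $\sigma\le\pi$ if $\pi$ has a subsequence order-isomorphic to $\sigma$. The Möbius function: $\mu[\sigma,\pi]=0$ if $\sigma\not\le\pi$, $\mu[\sigma,\pi]=1$ if $\sigma=\pi$, and $\mu[\sigma,\pi]=-\sum_{\sigma\le\tau<\pi}\mu[\sigma,\tau]$ otherwise; $1$ is the permutation of length one. For a permutation $\tau$ of length $m$, distinct indices $i,j\le m$ and non-empty permutations $\phi,\psi$, the inflation $\tau_{i,j}[\phi,\psi]$ is the permutation obtained from $\tau$ by replacing the entry $\tau_i$ by a block of $|\phi|$ consecutive positions whose values form a set of consecutive integers and are order-isomorphic to $\phi$, replacing $\tau_j$ likewise by a block order-isomorphic to $\psi$, and keeping every other entry as a single entry, so that the relative order between different blocks/entries is that of the corresponding entries of $\tau$. -}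

module Defs where

open import Data.Bool using (Bool; true; false; _∧_; _∨_; if_then_else_; not)
open import Data.Nat using (ℕ; zero; suc; _+_; _<ᵇ_; _≡ᵇ_)
open import Data.List using (List; []; _∷_; length; map; concat; concatMap; filter; deduplicate; upTo; foldr)
open import Data.Bool.ListAction using (and; any)
open import Data.Nat.ListAction using (sum)
open import Data.List.Properties using (≡-dec)
open import Data.Integer using (ℤ; -_) renaming (_+_ to _+ℤ_)
import Data.Nat as N
open import Data.List.Relation.Binary.Permutation.Propositional using (_↭_)

-- Conventions.  A permutation of length n is a list of natural numbers
-- that is a rearrangement of 1,2,…,n (one-line notation, 1-based values).
-- Positions are 1-based as in the paper.

IsPerm : List ℕ → Set
IsPerm π = π ↭ map suc (upTo (length π))

-- entry at 0-based position k (default 0 outside the list)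
at : List ℕ → ℕ → ℕ
at []       _       = 0
at (x ∷ xs) zero    = x
at (x ∷ xs) (suc k) = at xs k

_==ᵇ_ : Bool → Bool → Bool
true  ==ᵇ b = b
false ==ᵇ b = not b

orderIsoᵇ : List ℕ → List ℕ → Bool
orderIsoᵇ s t =
  (length s ≡ᵇ length t) ∧
  and (concatMap (λ a → map (λ b → (at s a <ᵇ at s b) ==ᵇ (at t a <ᵇ at t b))
                              (upTo (length s)))
                 (upTo (length s)))

subseqs : List ℕ → List (List ℕ)
subseqs []       = [] ∷ []
subseqs (x ∷ xs) = let r = subseqs xs in map (x ∷_) r Data.List.++ r

containsᵇ : List ℕ → List ℕ → Bool
containsᵇ σ π = any (λ s → orderIsoᵇ s σ) (subseqs π)

-- standardisation: replace each entry by 1 + number of entries smaller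
-- than it (the permutation order-isomorphic to a list of distinct values)
st : List ℕ → List ℕ
st s = map (λ x → suc (length (filter (λ y → y N.<? x) s))) s

-- all permutations τ ≤ π with |τ| < |π|  (i.e. the τ ≤ π with τ ≠ π),
-- each listed once
properPatterns : List ℕ → List (List ℕ)
properPatterns π =
  deduplicate (≡-dec N._≟_)
    (map st (filter (λ s → suc (length s) N.≤? length π) (subseqs π)))

_≡Lᵇ_ : List ℕ → List ℕ → Bool
σ ≡Lᵇ π = Relation.Nullary.Decidable.Core.does (≡-dec N._≟_ σ π)
  where import Relation.Nullary.Decidable.Core

sumℤ : List ℤ → ℤ
sumℤ = foldr _+ℤ_ (ℤ.pos 0)
  where open Data.Integer using (ℤ)

-- Möbius function, by the defining recursion
--   μ[σ,π] = 0 if σ ≰ π,  1 if σ = π,  − Σ_{σ ≤ τ < π} μ[σ,τ] otherwise.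
-- The fuel argument bounds the length of π (every τ < π is shorter).
mobiusF : ℕ → List ℕ → List ℕ → ℤ
mobiusF fuel σ π with σ ≡Lᵇ π | containsᵇ σ π
... | true  | _     = ℤ.pos 1
  where open Data.Integer using (ℤ)
... | false | false = ℤ.pos 0
  where open Data.Integer using (ℤ)
mobiusF zero       σ π | false | true = ℤ.pos 0
  where open Data.Integer using (ℤ)
mobiusF (suc fuel) σ π | false | true =
  - sumℤ (map (mobiusF fuel σ)
              (filter (λ τ → Relation.Nullary.Decidable.Core.T? (containsᵇ σ τ))
                      (properPatterns π)))
  where import Relation.Nullary.Decidable.Core

μ[_,_] : List ℕ → List ℕ → ℤ
μ[ σ , π ] = mobiusF (length π) σ π

-- Inflation τ_{i,j}[φ,ψ]  (i, j are 1-based positions of τ).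

blockAt : ℕ → ℕ → List ℕ → List ℕ → ℕ → List ℕ
blockAt i j φ ψ k =
  if k ≡ᵇ i then φ else if k ≡ᵇ j then ψ else (1 ∷ [])

inflate : List ℕ → ℕ → ℕ → List ℕ → List ℕ → List ℕ
inflate τ i j φ ψ = concatMap entry positions
  where
  positions = map suc (upTo (length τ))
  size : ℕ → ℕ
  size k = length (blockAt i j φ ψ k)
  offset : ℕ → ℕ
  offset k = sum (map (λ l → if at τ (N.pred l) <ᵇ at τ (N.pred k) then size l else 0)
                      positions)
  entry : ℕ → List ℕ
  entry k = map (λ x → x + offset k) (blockAt i j φ ψ k)

{-# OPTIONS --safe #-}
module Submission where

-- Write M ρ for μ[1,ρ]; summed over all patterns of a word of length at least two, M gives 0.
-- Let π contain disjoint interval copies of φ and ψ, and for sub-blocks a of φ and b of ψ let π[a,b] be the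
-- subword of π in which the copies are cut down to a and b.  Suppose integers c(a,b), zero for (a,b) = (φ,ψ),
-- are such that every pattern ρ < π with M ρ ≠ 0 satisfies 1 = Σ c(a,b)·[ρ ≤ π[a,b]].  Then, exchanging sums,
-- the sum of M over the proper patterns of π is Σ c(a,b)·0 = 0, so M π = 0.
--
-- The condition is finite.  An embedding of ρ into π leaves interval copies of some patterns p ≤ φ, q ≤ ψ in ρ,
-- and ρ ≤ π[a,b] iff some embedding has p ≤ a and q ≤ b.  If M ρ ≠ 0, then the copies left by all the embeddings
-- together contain no pair already known to be annihilating, nor, by induction on the length, the pair (φ,ψ)
-- itself.  Treating the pairs (12,21), (321,∅), (213,2431), (2143,2431) in this order, these exclusions suffice
-- for an identity with coefficients c that an exhaustive search verifies.

open import Defs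
open import Data.Bool using (Bool; true; false; T; if_then_else_; _∧_; _∨_; not; b≤b; f≤t)
  renaming (_≤_ to _≤ᵇ_)
open import Data.Bool.ListAction using (any; all)
open import Data.Bool.Properties using (T-≡; T-∧; T-∨; T-not-≡) renaming (≤-minimum to ≤ᵇ-minimum)
open import Data.Fin using (zero; suc)
open import Data.Integer using (ℤ; -_; 1ℤ; -1ℤ) renaming (_+_ to _+ℤ_; _*_ to _*ℤ_; _≟_ to _≟ℤ_)
import Data.Integer.Properties as ℤ
import Data.Integer.Tactic.RingSolver as ℤSolver
open import Data.List using (List; []; _∷_; _++_; length; map; filter; deduplicate; upTo; concatMap;
  cartesianProductWith; zipWith)
open import Data.Nat using (ℕ; zero; suc; pred; _+_; _∸_; _≤_; _<_; z≤n; s≤s; _<ᵇ_; _≡ᵇ_; _≟_; _≤?_; _<?_)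
open import Data.List.Membership.DecPropositional _≟_ using () renaming (_∈?_ to _∈ℕ?_)
open import Data.List.Membership.Propositional using (_∈_; _∉_; lose; find)
open import Data.List.Membership.Propositional.Properties
  using (∈-map⁺; ∈-map⁻; ∈-++⁺ˡ; ∈-++⁺ʳ; ∈-++⁻; ∈-∃++;
         ∈-filter⁺; ∈-filter⁻; ∈-deduplicate⁺; ∈-deduplicate⁻; ∈-cartesianProductWith⁺; ∈-upTo⁺; ∈-upTo⁻)
open import Data.List.Membership.Propositional.Properties.WithK using (unique∧set⇒bag)
import Data.List.Properties as List
open import Data.List.Relation.Binary.BagAndSetEquality using (∼bag⇒↭)
open import Data.List.Relation.Binary.Disjoint.Propositional using (Disjoint)
open import Data.List.Relation.Binary.Infix.Heterogeneous using (MkView; toView)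
open import Data.List.Relation.Binary.Infix.Heterogeneous.Properties using (infix?)
open import Data.List.Relation.Binary.Permutation.Propositional as Perm using (_↭_; ↭-sym; ↭⇒↭ₛ)
import Data.List.Relation.Binary.Permutation.Setoid.Properties as Permutationₛ
open import Data.List.Relation.Binary.Pointwise using (Pointwise; []; _∷_; Pointwise-≡⇒≡)
open import Data.List.Relation.Binary.Sublist.Heterogeneous.Properties using (length-mono-≤; toPointwise)
open import Data.List.Relation.Binary.Sublist.Propositional
  using (_⊆_; []; _∷_; _∷ʳ_; minimum; ⊆-refl; ⊆-trans) renaming (lookup to ⊆-lookup)
open import Data.List.Relation.Binary.Sublist.Propositional.Properties
  using (All-resp-⊆) renaming (map⁺ to ⊆-map⁺; ++⁺ to ⊆-++⁺)
open import Data.List.Relation.Unary.All as All using (All; []; _∷_)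
import Data.List.Relation.Unary.All.Properties as All
open import Data.List.Relation.Unary.AllPairs using (AllPairs; []; _∷_)
import Data.List.Relation.Unary.AllPairs.Properties as AllPairs
open import Data.List.Relation.Unary.Any as Any using (here; there; any?; satisfied)
import Data.List.Relation.Unary.Any.Properties as Any
open import Data.List.Relation.Unary.Unique.DecPropositional _≟_ using (unique?)
open import Data.List.Relation.Unary.Unique.Propositional using (Unique)
import Data.List.Relation.Unary.Unique.Propositional.Properties as Unique
open import Data.Nat.Induction using (<-wellFounded)
open import Data.Nat.ListAction using (sum)
import Data.Nat.Properties as ℕ
open import Data.Nat.Tactic.RingSolver using (solve-∀)
open import Data.Product using (_×_; _,_; ∃-syntax; proj₁; proj₂; uncurry; map₂; swap)
open import Data.Sum as Sum using (_⊎_; inj₁; inj₂; [_,_]′)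
open import Data.Vec as Vec using (Vec; []; _∷_)
open import Data.Vec.Relation.Binary.Pointwise.Inductive using ([]; _∷_) renaming (Pointwise to VecPointwise)
open import Data.Vec.Relation.Unary.All as VecAll using ([]; _∷_) renaming (All to VecAll)
open import Function using (_∘_; _⇔_; mk⇔; Equivalence)
open import Induction.WellFounded using (Acc; acc)
open import Relation.Binary using (tri<; tri≈; tri>)
open import Relation.Binary.PropositionalEquality
open import Relation.Nullary using (Dec; ¬_; yes; no; contradiction; does)
open import Relation.Nullary.Decidable using (T?; True; isYes; toWitness; dec-true; dec-false; _×-dec_)
open import Relation.Unary using (Decidable; Pred)

_≟ᴸ_ : (s t : List ℕ) → Dec (s ≡ t)
_≟ᴸ_ = List.≡-dec _≟_

open import Data.List.Membership.DecPropositional _≟ᴸ_ using (_∈?_)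
open import Data.List.Relation.Unary.Unique.DecPropositional.Properties _≟ᴸ_ using (deduplicate-!)

-- Subsequences of a word and their patterns.

⊆⇒∈-subseqs : ∀ {s π} → s ⊆ π → s ∈ subseqs π
⊆⇒∈-subseqs []                    = here refl
⊆⇒∈-subseqs {π = _ ∷ π} (x ∷ʳ p)  = ∈-++⁺ʳ (map (x ∷_) (subseqs π)) (⊆⇒∈-subseqs p)
⊆⇒∈-subseqs (refl ∷ p)            = ∈-++⁺ˡ (∈-map⁺ _ (⊆⇒∈-subseqs p))

∈-subseqs⇒⊆ : ∀ {s} π → s ∈ subseqs π → s ⊆ π
∈-subseqs⇒⊆ []      (here refl) = []
∈-subseqs⇒⊆ (x ∷ π) p with ∈-++⁻ (map (x ∷_) (subseqs π)) p
... | inj₂ q = x ∷ʳ ∈-subseqs⇒⊆ π q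
... | inj₁ q with ∈-map⁻ (x ∷_) q
...   | _ , r , refl = refl ∷ ∈-subseqs⇒⊆ π r

⊆∧length≡⇒≡ : ∀ {s π : List ℕ} → s ⊆ π → length s ≡ length π → s ≡ π
⊆∧length≡⇒≡ p eq = Pointwise-≡⇒≡ (toPointwise eq p)

length-st : ∀ s → length (st s) ≡ length s
length-st s = List.length-map _ s

patterns : List ℕ → List (List ℕ)
patterns π = map st (subseqs π)

∈-patterns⁺ : ∀ {s π} → s ⊆ π → st s ∈ patterns π
∈-patterns⁺ p = ∈-map⁺ st (⊆⇒∈-subseqs p)

∈-patterns⁻ : ∀ {ρ} π → ρ ∈ patterns π → ∃[ s ] s ⊆ π × ρ ≡ st s
∈-patterns⁻ π p with ∈-map⁻ st p
... | s , q , refl = s , ∈-subseqs⇒⊆ π q , refl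

∈-properPatterns⁺ : ∀ {s π} → s ⊆ π → length s < length π → st s ∈ properPatterns π
∈-properPatterns⁺ {π = π} p lt =
  ∈-deduplicate⁺ _≟ᴸ_ (∈-map⁺ st (∈-filter⁺ (λ s → suc (length s) ≤? length π) (⊆⇒∈-subseqs p) lt))

∈-properPatterns⁻ : ∀ {ρ} π → ρ ∈ properPatterns π →
                    ∃[ s ] s ⊆ π × length s < length π × ρ ≡ st s
∈-properPatterns⁻ π p
  with ∈-map⁻ st (∈-deduplicate⁻ _≟ᴸ_ _ p)
... | s , q , refl with ∈-filter⁻ (λ s → suc (length s) ≤? length π) {xs = subseqs π} q
...   | r , lt = s , ∈-subseqs⇒⊆ π r , lt , refl

properPatterns-shorter : ∀ {ρ} π → ρ ∈ properPatterns π → length ρ < length π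
properPatterns-shorter π p with ∈-properPatterns⁻ π p
... | s , _ , lt , refl = subst (_< length π) (sym (length-st s)) lt

does⇒ : ∀ {P : Set} (d : Dec P) → does d ≡ true → P
does⇒ (yes p) _ = p

-- Sums of integers

Σ[_] : (List ℕ → ℤ) → List (List ℕ) → ℤ
Σ[ f ] xs = sumℤ (map f xs)

Σ-cong : ∀ {f g} xs → (∀ {x} → x ∈ xs → f x ≡ g x) → Σ[ f ] xs ≡ Σ[ g ] xs
Σ-cong xs eq = cong sumℤ (List.map-cong-local (All.tabulate eq))

Σ-↭ : ∀ f {xs ys} → xs ↭ ys → Σ[ f ] xs ≡ Σ[ f ] ys
Σ-↭ f Perm.refl          = refl
Σ-↭ f (Perm.prep x p)    = cong (f x +ℤ_) (Σ-↭ f p)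
Σ-↭ f (Perm.swap {xs} {ys} x y p)  = begin
  f x +ℤ (f y +ℤ Σ[ f ] xs)  ≡⟨ cong (λ z → f x +ℤ (f y +ℤ z)) (Σ-↭ f p) ⟩
  f x +ℤ (f y +ℤ Σ[ f ] ys)  ≡⟨ ℤ.+-assoc (f x) (f y) _ ⟨
  (f x +ℤ f y) +ℤ Σ[ f ] ys  ≡⟨ cong (_+ℤ Σ[ f ] ys) (ℤ.+-comm (f x) (f y)) ⟩
  (f y +ℤ f x) +ℤ Σ[ f ] ys  ≡⟨ ℤ.+-assoc (f y) (f x) _ ⟩
  f y +ℤ (f x +ℤ Σ[ f ] ys)  ∎ where open ≡-Reasoning
Σ-↭ f (Perm.trans p q)   = trans (Σ-↭ f p) (Σ-↭ f q)

Σ-filter : ∀ {p} {P : Pred (List ℕ) p} (P? : Decidable P) f xs →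
           Σ[ f ] (filter P? xs) ≡ Σ[ (λ x → if does (P? x) then f x else ℤ.pos 0) ] xs
Σ-filter P? f []       = refl
Σ-filter P? f (x ∷ xs) with P? x
... | yes _ = cong (f x +ℤ_) (Σ-filter P? f xs)
... | no  _ = trans (Σ-filter P? f xs) (sym (ℤ.+-identityˡ _))

Σ-filter-support : ∀ {p} {P : Pred (List ℕ) p} (P? : Decidable P) {f} xs →
                   (∀ {x} → ¬ P x → f x ≡ ℤ.pos 0) → Σ[ f ] (filter P? xs) ≡ Σ[ f ] xs
Σ-filter-support P? {f} xs off = trans (Σ-filter P? f xs) (Σ-cong xs on)
  where
  on : ∀ {x} → x ∈ xs → (if does (P? x) then f x else ℤ.pos 0) ≡ f x
  on {x} _ with P? x
  ... | yes _ = refl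
  ... | no ¬p = sym (off ¬p)

Σ-+ : ∀ f g xs → Σ[ (λ x → f x +ℤ g x) ] xs ≡ Σ[ f ] xs +ℤ Σ[ g ] xs
Σ-+ f g []       = refl
Σ-+ f g (x ∷ xs) = trans (cong (f x +ℤ g x +ℤ_) (Σ-+ f g xs)) (shuffle (f x) (g x) _ _)
  where
  shuffle : ∀ a b c d → (a +ℤ b) +ℤ (c +ℤ d) ≡ (a +ℤ c) +ℤ (b +ℤ d)
  shuffle = ℤSolver.solve-∀

Σ-* : ∀ c f xs → Σ[ (λ x → c *ℤ f x) ] xs ≡ c *ℤ Σ[ f ] xs
Σ-* c f []       = sym (ℤ.*-zeroʳ c)
Σ-* c f (x ∷ xs) = trans (cong (c *ℤ f x +ℤ_) (Σ-* c f xs)) (sym (ℤ.*-distribˡ-+ c (f x) _))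

Σ-same-elements : ∀ f {xs ys} → Unique xs → Unique ys → (∀ {x} → x ∈ xs ⇔ x ∈ ys) →
                  Σ[ f ] xs ≡ Σ[ f ] ys
Σ-same-elements f u v eq = Σ-↭ f (∼bag⇒↭ (unique∧set⇒bag u v eq))

-- The Möbius function from the permutation 1

<ᵇ-irrefl : ∀ x → (x <ᵇ x) ≡ false
<ᵇ-irrefl zero    = refl
<ᵇ-irrefl (suc x) = <ᵇ-irrefl x

contains-1 : ∀ x xs → containsᵇ (1 ∷ []) (x ∷ xs) ≡ true
contains-1 x xs = Equivalence.to T-≡
  (Any.any⁺ (λ s → orderIsoᵇ s (1 ∷ [])) (lose (⊆⇒∈-subseqs (refl ∷ minimum xs)) iso))
  where
  iso : T (orderIsoᵇ (x ∷ []) (1 ∷ []))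
  iso rewrite <ᵇ-irrefl x = _

M : List ℕ → ℤ
M = μ[ 1 ∷ [] ,_]

mobiusF-suc : ∀ f π → ((1 ∷ []) ≡Lᵇ π) ≡ false → containsᵇ (1 ∷ []) π ≡ true →
              mobiusF (suc f) (1 ∷ []) π ≡
              - Σ[ mobiusF f (1 ∷ []) ] (filter (λ τ → T? (containsᵇ (1 ∷ []) τ)) (properPatterns π))
mobiusF-suc f π eq c rewrite eq | c = refl

mobiusF-1 : ∀ f π → ((1 ∷ []) ≡Lᵇ π) ≡ true → mobiusF f (1 ∷ []) π ≡ ℤ.pos 1
mobiusF-1 f π eq rewrite eq = refl

-- Each unfolding passes to strictly shorter patterns, so fuel at least the length never runs out.
-- The empty word does not contain 1 and has value 0 at any fuel.
mobiusF-fuel : ∀ f g π → length π ≤ f → length π ≤ g →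
               mobiusF f (1 ∷ []) π ≡ mobiusF g (1 ∷ []) π
mobiusF-fuel f       g       []       _       _       = refl
mobiusF-fuel (suc f) (suc g) π@(x ∷ xs) (s≤s p) (s≤s q) = by-cases _ refl
  where
  open ≡-Reasoning
  contained? = λ τ → T? (containsᵇ (1 ∷ []) τ)
  below = filter contained? (properPatterns π)
  step : ∀ {ρ} → ρ ∈ below → mobiusF f (1 ∷ []) ρ ≡ mobiusF g (1 ∷ []) ρ
  step {ρ} r with properPatterns-shorter π (proj₁ (∈-filter⁻ contained? {xs = properPatterns π} r))
  ... | s≤s lt = mobiusF-fuel f g ρ (ℕ.≤-trans lt p) (ℕ.≤-trans lt q)
  by-cases : ∀ b → ((1 ∷ []) ≡Lᵇ π) ≡ b →
             mobiusF (suc f) (1 ∷ []) π ≡ mobiusF (suc g) (1 ∷ []) π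
  by-cases true  eq = trans (mobiusF-1 (suc f) π eq) (sym (mobiusF-1 (suc g) π eq))
  by-cases false eq = begin
    mobiusF (suc f) (1 ∷ []) π      ≡⟨ mobiusF-suc f π eq (contains-1 x xs) ⟩
    - Σ[ mobiusF f (1 ∷ []) ] below ≡⟨ cong -_ (Σ-cong below step) ⟩
    - Σ[ mobiusF g (1 ∷ []) ] below ≡⟨ mobiusF-suc g π eq (contains-1 x xs) ⟨
    mobiusF (suc g) (1 ∷ []) π      ∎

M-uncontained : ∀ ρ → ¬ T (containsᵇ (1 ∷ []) ρ) → M ρ ≡ ℤ.pos 0
M-uncontained []       _ = refl
M-uncontained (x ∷ xs) n = contradiction (Equivalence.from T-≡ (contains-1 x xs)) n

-- The filter in the recursion drops only words with `M` equal to 0, so the sum may run over all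
-- proper patterns. Length two keeps π away from `1 ∷ []`, where the recursion starts with the value
-- 1.
Σ-properPatterns : ∀ π → 2 ≤ length π → M π +ℤ Σ[ M ] (properPatterns π) ≡ ℤ.pos 0
Σ-properPatterns π@(x ∷ y ∷ zs) (s≤s (s≤s _)) = begin
  M π +ℤ Σ[ M ] (properPatterns π)        ≡⟨ cong (_+ℤ Σ[ M ] (properPatterns π)) M≡ ⟩
  - Σ[ M ] (properPatterns π) +ℤ Σ[ M ] (properPatterns π)
                                          ≡⟨ ℤ.+-inverseˡ (Σ[ M ] (properPatterns π)) ⟩
  ℤ.pos 0                                 ∎
  where
  open ≡-Reasoning
  contained? = λ τ → T? (containsᵇ (1 ∷ []) τ)
  step : ∀ {ρ} → ρ ∈ filter contained? (properPatterns π) →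
         mobiusF (suc (length zs)) (1 ∷ []) ρ ≡ M ρ
  step {ρ} r with properPatterns-shorter π (proj₁ (∈-filter⁻ contained? {xs = properPatterns π} r))
  -- One unfolding leaves one unit of fuel less than the length of π, still enough for every proper
  -- pattern.
  ... | s≤s lt = mobiusF-fuel _ _ ρ lt ℕ.≤-refl
  M≡ : M π ≡ - Σ[ M ] (properPatterns π)
  M≡ = begin
    M π
      ≡⟨ mobiusF-suc _ π (dec-false ((1 ∷ []) ≟ᴸ π) (λ ())) (contains-1 x (y ∷ zs)) ⟩
    - Σ[ mobiusF (suc (length zs)) (1 ∷ []) ] (filter contained? (properPatterns π))
      ≡⟨ cong -_ (Σ-cong (filter contained? (properPatterns π)) step) ⟩
    - Σ[ M ] (filter contained? (properPatterns π))
      ≡⟨ cong -_ (Σ-filter-support contained? (properPatterns π) (λ {ρ} → M-uncontained ρ)) ⟩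
    - Σ[ M ] (properPatterns π) ∎

-- Ranks and standardisation.

below : ℕ → List ℕ → ℕ
below x s = length (filter (_<? x) s)

rank : List ℕ → ℕ → ℕ
rank s x = suc (below x s)

below-++ : ∀ x s t → below x (s ++ t) ≡ below x s + below x t
below-++ x s t = trans (cong length (List.filter-++ (_<? x) s t)) (List.length-++ (filter (_<? x) s))

below-accept : ∀ {x y} s → y < x → below x (y ∷ s) ≡ suc (below x s)
below-accept s p = cong length (List.filter-accept (_<? _) p)

below-reject : ∀ {x y} s → ¬ y < x → below x (y ∷ s) ≡ below x s
below-reject s ¬p = cong length (List.filter-reject (_<? _) ¬p)

below-map : ∀ (f : ℕ → ℕ) {x} x′ s → All (λ y → y < x ⇔ f y < x′) s → below x′ (map f s) ≡ below x s
below-map f     x′ []      []       = refl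
below-map f {x} x′ (y ∷ s) (e ∷ es) = by-cases (y <? x)
  where
  by-cases : Dec (y < x) → below x′ (map f (y ∷ s)) ≡ below x (y ∷ s)
  by-cases (yes p) rewrite below-accept s p | below-accept (map f s) (Equivalence.to e p) =
    cong suc (below-map f x′ s es)
  by-cases (no ¬p) rewrite below-reject s ¬p | below-reject (map f s) (¬p ∘ Equivalence.from e) =
    below-map f x′ s es

below-mono-≤ : ∀ {x x′} s → x ≤ x′ → below x s ≤ below x′ s
below-mono-≤ []      _ = z≤n
below-mono-≤ {x} {x′} (y ∷ s) p = by-cases (y <? x) (y <? x′)
  where
  by-cases : Dec (y < x) → Dec (y < x′) → below x (y ∷ s) ≤ below x′ (y ∷ s)
  by-cases (yes q) _ rewrite below-accept s q | below-accept s (ℕ.<-≤-trans q p) =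
    s≤s (below-mono-≤ s p)
  by-cases (no ¬q) (yes q′) rewrite below-reject s ¬q | below-accept s q′ =
    ℕ.m≤n⇒m≤1+n (below-mono-≤ s p)
  by-cases (no ¬q) (no ¬q′) rewrite below-reject s ¬q | below-reject s ¬q′ =
    below-mono-≤ s p

below-mono-< : ∀ {x x′ s} → x ∈ s → x < x′ → below x s < below x′ s
below-mono-< {x} {x′} {s} i p with ∈-∃++ i
... | t , u , refl
  rewrite below-++ x t (x ∷ u) | below-++ x′ t (x ∷ u)
        | below-reject u (ℕ.<-irrefl {x} refl) | below-accept u p =
  ℕ.+-mono-≤-< (below-mono-≤ t (ℕ.<⇒≤ p)) (s≤s (below-mono-≤ u (ℕ.<⇒≤ p)))

rank-< : ∀ {x y s} → y ∈ s → y < x ⇔ rank s y < rank s x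
rank-< {x} {y} {s} i = mk⇔ (λ p → s≤s (below-mono-< i p)) back
  where
  back : rank s y < rank s x → y < x
  back (s≤s q) with y <? x
  ... | yes p = p
  ... | no ¬p = contradiction q (ℕ.≤⇒≯ (below-mono-≤ s (ℕ.≮⇒≥ ¬p)))

rank-injective : ∀ {x y s} → x ∈ s → y ∈ s → rank s x ≡ rank s y → x ≡ y
rank-injective {x} {y} {s} i j eq with ℕ.<-cmp x y
... | tri< p _ _ = contradiction (below-mono-< i p) (ℕ.<-irrefl (ℕ.suc-injective eq))
... | tri≈ _ p _ = p
... | tri> _ _ p = contradiction (below-mono-< j p) (ℕ.<-irrefl (sym (ℕ.suc-injective eq)))

Unique-map∈ : ∀ {f : ℕ → ℕ} {s} → (∀ {x y} → x ∈ s → y ∈ s → f x ≡ f y → x ≡ y) → Unique s → Unique (map f s)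
Unique-map∈ {s = []}    inj []      = []
Unique-map∈ {f} {x ∷ s} inj (p ∷ u) =
  All.tabulate fresh ∷ Unique-map∈ (λ i j → inj (there i) (there j)) u
  where
  fresh : ∀ {z} → z ∈ map f s → f x ≢ z
  fresh z∈ eq with ∈-map⁻ f z∈
  ... | y , j , refl = All.lookup p j (inj (here refl) (there j) eq)

st-unique : ∀ {s} → Unique s → Unique (st s)
st-unique = Unique-map∈ rank-injective

st-map : ∀ f s → (∀ {x y} → x ∈ s → y ∈ s → y < x ⇔ f y < f x) → st (map f s) ≡ st s
st-map f s mono = trans (sym (List.map-∘ s))
  (List.map-cong-local (All.tabulate λ {x} i → cong suc (below-map f (f x) s (All.tabulate λ j → mono i j))))

⊆-map⁻ : ∀ {f : ℕ → ℕ} {s} t → s ⊆ map f t → ∃[ s′ ] s′ ⊆ t × s ≡ map f s′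
⊆-map⁻ []      []          = [] , [] , refl
⊆-map⁻ (x ∷ t) (_ ∷ʳ p)    with ⊆-map⁻ t p
... | s′ , q , refl = s′ , x ∷ʳ q , refl
⊆-map⁻ (x ∷ t) (refl ∷ p) with ⊆-map⁻ t p
... | s′ , q , refl = x ∷ s′ , refl ∷ q , refl

⊆-++⁻ : ∀ {s : List ℕ} t {t′} → s ⊆ t ++ t′ → ∃[ u ] ∃[ u′ ] s ≡ u ++ u′ × u ⊆ t × u′ ⊆ t′
⊆-++⁻ []      p          = [] , _ , refl , [] , p
⊆-++⁻ (x ∷ t) (_ ∷ʳ p)   with ⊆-++⁻ t p
... | u , u′ , refl , q , q′ = u , u′ , refl , x ∷ʳ q , q′
⊆-++⁻ (x ∷ t) (refl ∷ p) with ⊆-++⁻ t p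
... | u , u′ , refl , q , q′ = x ∷ u , u′ , refl , refl ∷ q , q′

⊆-Unique : ∀ {s t : List ℕ} → s ⊆ t → Unique t → Unique s
⊆-Unique []         u       = u
⊆-Unique (_ ∷ʳ p)   (_ ∷ u) = ⊆-Unique p u
⊆-Unique (refl ∷ p) (f ∷ u) = All.tabulate (λ i → All.lookup f (⊆-lookup p i)) ∷ ⊆-Unique p u

-- `st t` is `map (rank t) t`, and `rank t` preserves order on `t`. This identifies the patterns of
-- `st t` with those of `t`.
st-rank-sublist : ∀ {s t} → s ⊆ t → st (map (rank t) s) ≡ st s
st-rank-sublist {s} {t} p = st-map (rank t) s (λ _ j → rank-< (⊆-lookup p j))

-- The Möbius sum over the patterns of a subword.

properPatterns-unique : ∀ π → Unique (properPatterns π)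
properPatterns-unique π =
  deduplicate-! (map st (filter (λ s → suc (length s) ≤? length π) (subseqs π)))

-- The proper patterns of π that lie below x are exactly `st x` and its proper patterns, so this is
-- the vanishing sum of `Σ-properPatterns` for `st x`. It is why each term π[a,b] contributes
-- nothing.
Σ-patterns : ∀ {x π} → x ⊆ π → length x < length π → 2 ≤ length x →
  Σ[ (λ ρ → if does (ρ ∈? patterns x) then M ρ else ℤ.pos 0) ] (properPatterns π) ≡ ℤ.pos 0
Σ-patterns {x} {π} x⊆π lt two = begin
  Σ[ (λ ρ → if does (ρ ∈? patterns x) then M ρ else ℤ.pos 0) ] (properPatterns π)
    ≡⟨ Σ-filter (_∈? patterns x) M (properPatterns π) ⟨
  Σ[ M ] (filter (_∈? patterns x) (properPatterns π))
    ≡⟨ Σ-same-elements M (Unique.filter⁺ (_∈? patterns x) (properPatterns-unique π))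
                         (All.tabulate new ∷ properPatterns-unique (st x)) (mk⇔ to from) ⟩
  Σ[ M ] (st x ∷ properPatterns (st x))
    ≡⟨ Σ-properPatterns (st x) (subst (2 ≤_) (sym (length-st x)) two) ⟩
  ℤ.pos 0 ∎
  where
  open ≡-Reasoning
  new : ∀ {ρ} → ρ ∈ properPatterns (st x) → st x ≢ ρ
  new i refl = ℕ.<-irrefl refl (properPatterns-shorter (st x) i)
  to : ∀ {ρ} → ρ ∈ filter (_∈? patterns x) (properPatterns π) → ρ ∈ st x ∷ properPatterns (st x)
  to i with ∈-patterns⁻ x (proj₂ (∈-filter⁻ (_∈? patterns x) {xs = properPatterns π} i))
  ... | s , s⊆x , refl with length s ≟ length x
  ...   | yes eq = here (cong st (⊆∧length≡⇒≡ s⊆x eq))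
  ...   | no neq = there (subst (_∈ properPatterns (st x)) (st-rank-sublist s⊆x)
            (∈-properPatterns⁺ (⊆-map⁺ (rank x) s⊆x)
              (subst₂ _<_ (sym (List.length-map _ s)) (sym (length-st x))
                (ℕ.≤∧≢⇒< (length-mono-≤ s⊆x) neq))))
  from : ∀ {ρ} → ρ ∈ st x ∷ properPatterns (st x) → ρ ∈ filter (_∈? patterns x) (properPatterns π)
  from (here refl) = ∈-filter⁺ (_∈? patterns x) (∈-properPatterns⁺ x⊆π lt) (∈-patterns⁺ ⊆-refl)
  from (there i) with ∈-properPatterns⁻ (st x) i
  ... | s , s⊆ , _ , refl with ⊆-map⁻ x s⊆
  ...   | s′ , s′⊆x , refl = subst (_∈ filter (_∈? patterns x) (properPatterns π)) (sym (st-rank-sublist s′⊆x))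
            (∈-filter⁺ (_∈? patterns x)
              (∈-properPatterns⁺ (⊆-trans s′⊆x x⊆π) (ℕ.≤-<-trans (length-mono-≤ s′⊆x) lt))
              (∈-patterns⁺ s′⊆x))

-- Standardisation around a block of consecutive values.

Outside : ℕ → ℕ → ℕ → Set
Outside k n y = y ≤ k ⊎ k + n < y

InBlock : ℕ → ℕ → Set
InBlock n x = 1 ≤ x × x ≤ n

below-cong : ∀ {x x′} s → All (λ y → y < x ⇔ y < x′) s → below x′ s ≡ below x s
below-cong {x} {x′} s e = trans (cong (below x′) (sym (List.map-id s))) (below-map (λ y → y) x′ s e)

below-outside : ∀ {k n x s} → All (Outside k n) s → InBlock n x → below (k + x) s ≡ below (suc k) s
below-outside {k} {n} {x} {s} out (1≤x , x≤n) = below-cong s (All.map same out)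
  where
  same : ∀ {y} → Outside k n y → y < suc k ⇔ y < k + x
  same (inj₁ y≤k) = mk⇔ (λ _ → ℕ.≤-<-trans y≤k (ℕ.m<m+n k 1≤x)) (λ _ → s≤s y≤k)
  same (inj₂ y>)  = mk⇔
    (λ { (s≤s y≤k) → contradiction (ℕ.≤-trans y≤k (ℕ.m≤m+n k n)) (ℕ.<⇒≱ y>) })
    (λ y< → contradiction (ℕ.<-≤-trans y< (ℕ.+-monoʳ-≤ k x≤n)) (ℕ.<-asym y>))

below-block : ∀ {k n y c} → Outside k n y → All (InBlock n) c →
              below y (map (k +_) c) ≡ (if does (k <? y) then length c else 0)
below-block {k} {n} {y} {c} out ins = by-cases out (k <? y)
  where
  by-cases : Outside k n y → (d : Dec (k < y)) →
             below y (map (k +_) c) ≡ (if does d then length c else 0)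
  by-cases (inj₁ y≤k) (yes k<y) = contradiction k<y (ℕ.≤⇒≯ y≤k)
  by-cases _          (no k≮y)  = cong length
    (List.filter-none (_<? y) (All.map⁺ (All.universal (λ x p → k≮y (ℕ.m+n≤o⇒m≤o (suc k) p)) c)))
  by-cases (inj₂ y>) (yes _)   = trans
    (cong length (List.filter-all (_<? y)
      (All.map⁺ (All.map (λ { (_ , x≤n) → ℕ.≤-<-trans (ℕ.+-monoʳ-≤ k x≤n) y> }) ins))))
    (List.length-map (k +_) c)

module _ (k : ℕ) (u w : List ℕ) where

  contextRank : ℕ → ℕ → ℕ
  contextRank len y = suc (below y u + ((if does (k <? y) then len else 0) + below y w))

  blockShift : ℕ
  blockShift = below (suc k) u + below (suc k) w

  -- A value outside the range k+1,...,k+n lies above all of the block or below all of it. So the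
  -- context raises the ranks of all block entries by one amount, and the block enters the ranks of
  -- the context only through its length.
  st-block : ∀ {n c} → All (Outside k n) u → All (Outside k n) w → All (InBlock n) c →
             st (u ++ map (k +_) c ++ w) ≡
             map (contextRank (length c)) u ++ map (blockShift +_) (st c) ++ map (contextRank (length c)) w
  st-block {n} {c} out-u out-w ins = begin
    map (rank s) s
      ≡⟨ List.map-++ (rank s) u _ ⟩
    map (rank s) u ++ map (rank s) (map (k +_) c ++ w)
      ≡⟨ cong (map (rank s) u ++_) (List.map-++ (rank s) (map (k +_) c) w) ⟩
    map (rank s) u ++ map (rank s) (map (k +_) c) ++ map (rank s) w
      ≡⟨ cong₂ _++_ (List.map-cong-local (All.map context out-u))
           (cong₂ _++_
             (trans (sym (List.map-∘ c)) (trans (List.map-cong-local (All.map block ins)) (List.map-∘ c)))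
             (List.map-cong-local (All.map context out-w))) ⟩
    map (contextRank (length c)) u ++ map (blockShift +_) (st c) ++ map (contextRank (length c)) w ∎
    where
    open ≡-Reasoning
    s = u ++ map (k +_) c ++ w
    split : ∀ y → below y s ≡ below y u + (below y (map (k +_) c) + below y w)
    split y = trans (below-++ y u _) (cong (below y u +_) (below-++ y (map (k +_) c) w))
    context : ∀ {y} → Outside k n y → rank s y ≡ contextRank (length c) y
    context {y} out = cong suc (trans (split y)
      (cong (λ z → below y u + (z + below y w)) (below-block out ins)))
    shuffle : ∀ a b d → suc (a + (b + d)) ≡ (a + d) + suc b
    shuffle = solve-∀
    block : ∀ {x} → InBlock n x → rank s (k + x) ≡ blockShift + rank c x
    block {x} ix
      rewrite split (k + x) | below-outside out-u ix | below-outside out-w ix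
            | below-map (k +_) {x} (k + x) c
                (All.universal (λ y → mk⇔ (ℕ.+-monoʳ-< k) (ℕ.+-cancelˡ-< k y x)) c) =
      shuffle (below (suc k) u) (below x c) (below (suc k) w)

  st-block-cong : ∀ {n c c′} → All (Outside k n) u → All (Outside k n) w →
                  All (InBlock n) c → All (InBlock n) c′ → st c ≡ st c′ →
                  st (u ++ map (k +_) c ++ w) ≡ st (u ++ map (k +_) c′ ++ w)
  st-block-cong {c = c} {c′} ou ow ic ic′ eq
    rewrite st-block ou ow ic | st-block ou ow ic′ | eq
          | trans (sym (length-st c)) (trans (cong length eq) (length-st c′)) = refl

-- Interval copies

Occurs : List ℕ → List ℕ → Set
Occurs a ρ = ∃[ u ] ∃[ k ] ∃[ w ] ρ ≡ u ++ map (k +_) a ++ w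

-- Hence a pattern inherits an interval copy of whatever its embedding takes from a block.
Occurs-st : ∀ {k n u w c} → All (Outside k n) u → All (Outside k n) w → All (InBlock n) c →
            Occurs (st c) (st (u ++ map (k +_) c ++ w))
Occurs-st {k} {u = u} {w} {c} ou ow ic =
  map (contextRank k u w (length c)) u , blockShift k u w , map (contextRank k u w (length c)) w ,
  st-block k u w ou ow ic

Occurs-trans : ∀ {a b c} → Occurs a b → Occurs b c → Occurs a c
Occurs-trans {a} (u , k , w , refl) (u′ , l , w′ , refl) =
  u′ ++ map (l +_) u , l + k , map (l +_) w ++ w′ , (begin
  u′ ++ map (l +_) (u ++ map (k +_) a ++ w) ++ w′
    ≡⟨ cong (λ z → u′ ++ z ++ w′)
         (trans (List.map-++ _ u _) (cong (map (l +_) u ++_) (List.map-++ _ (map (k +_) a) w))) ⟩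
  u′ ++ (map (l +_) u ++ map (l +_) (map (k +_) a) ++ map (l +_) w) ++ w′
    ≡⟨ cong (λ z → u′ ++ (map (l +_) u ++ z ++ map (l +_) w) ++ w′)
         (trans (sym (List.map-∘ a)) (List.map-cong (λ x → sym (ℕ.+-assoc l k x)) a)) ⟩
  u′ ++ (map (l +_) u ++ map (l + k +_) a ++ map (l +_) w) ++ w′
    ≡⟨ cong (u′ ++_) (List.++-assoc (map (l +_) u) _ w′) ⟩
  u′ ++ map (l +_) u ++ (map (l + k +_) a ++ map (l +_) w) ++ w′
    ≡⟨ List.++-assoc u′ (map (l +_) u) _ ⟨
  (u′ ++ map (l +_) u) ++ (map (l + k +_) a ++ map (l +_) w) ++ w′
    ≡⟨ cong ((u′ ++ map (l +_) u) ++_) (List.++-assoc (map (l + k +_) a) _ w′) ⟩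
  (u′ ++ map (l +_) u) ++ map (l + k +_) a ++ map (l +_) w ++ w′ ∎)
  where open ≡-Reasoning

-- In a standardised `c` no value exceeds the length, which bounds the shifts to try. A missed copy
-- would only make the search discard fewer cases, so soundness is the direction that matters.
occursᵇ : List ℕ → List ℕ → Bool
occursᵇ a c = isYes (any? (λ k → infix? _≟_ (map (k +_) a) c) (upTo (suc (length c))))

occursᵇ-sound : ∀ a c → T (occursᵇ a c) → Occurs a c
occursᵇ-sound a c t
  with satisfied (toWitness {a? = any? (λ k → infix? _≟_ (map (k +_) a) c) (upTo (suc (length c)))} t)
... | k , inf with toView inf
...   | MkView u eq w with Pointwise-≡⇒≡ eq
...     | refl = u , k , w , refl

-- Disjointness of interval copies

word : List ℕ → ℕ → List ℕ → List ℕ → ℕ → List ℕ → List ℕ → List ℕ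
word u k a m l b w = u ++ map (k +_) a ++ m ++ map (l +_) b ++ w

Paired : List ℕ → List ℕ → List ℕ → Set
Paired a b π = ∃[ u ] ∃[ k ] ∃[ m ] ∃[ l ] ∃[ w ] π ≡ word u k a m l b w

-- clash [] a b excludes that a copy of b starts inside a copy of a.  Aligning the entry x of a with the first
-- entry z of b fixes the difference of the value shifts; then either two aligned entries disagree, or an
-- entry of a before x (collected in e) reappears as a value of b, so that the word repeats a value.
mismatch : ℕ → ℕ → List ℕ → List ℕ → Bool
mismatch x z (a ∷ as) (b ∷ bs) = not (a + z ≡ᵇ b + x) ∨ mismatch x z as bs
mismatch x z _        _        = false

clashAt : List ℕ → ℕ → List ℕ → List ℕ → Bool
clashAt e x as []       = false
clashAt e x as (z ∷ bs) = mismatch x z as bs ∨ any (λ y → any (λ b → y + z ≡ᵇ b + x) bs) e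

clash : List ℕ → List ℕ → List ℕ → Bool
clash e []       b = true
clash e (x ∷ as) b = clashAt e x as b ∧ clash (x ∷ e) as b

-- Equal words would give `k + a ≡ l + b`; adding this crosswise to `k + x ≡ l + z` yields
-- `a + z ≡ b + x`, the tested equation, stated without subtraction.
mismatch-sound : ∀ {k l x z} as bs {w w′} → k + x ≡ l + z → T (mismatch x z as bs) →
                 map (k +_) as ++ w ≢ map (l +_) bs ++ w′
mismatch-sound {k} {l} {x} {z} (a ∷ as) (b ∷ bs) xz t eq
  with Equivalence.to (T-∨ {x = not (a + z ≡ᵇ b + x)}) t
... | inj₂ t′ = mismatch-sound as bs xz t′ (List.∷-injectiveʳ eq)
... | inj₁ t′ =
  contradiction (trans (sym (Equivalence.to T-≡ (ℕ.≡⇒≡ᵇ _ _ az≡bx))) (Equivalence.to T-not-≡ t′)) λ ()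
  where
  shuffle : ∀ p q r s → (p + q) + (r + s) ≡ (p + r) + (q + s)
  shuffle = solve-∀
  az≡bx : a + z ≡ b + x
  az≡bx = ℕ.+-cancelˡ-≡ (k + l) (a + z) (b + x) (begin
    (k + l) + (a + z)  ≡⟨ shuffle k l a z ⟩
    (k + a) + (l + z)  ≡⟨ cong₂ _+_ (List.∷-injectiveˡ eq) (sym xz) ⟩
    (l + b) + (k + x)  ≡⟨ shuffle l b k x ⟩
    (l + k) + (b + x)  ≡⟨ cong (_+ (b + x)) (ℕ.+-comm l k) ⟩
    (k + l) + (b + x)  ∎)
    where open ≡-Reasoning

-- In the second case `y + z ≡ b + x` turns the earlier entry `k + y` into `l + b`, an entry of the
-- second copy, where `fresh` forbids it.
clashAt-sound : ∀ {k l} e x as b {w w′} → All (λ y → k + y ∉ map (k +_) (x ∷ as) ++ w) e →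
                T (clashAt e x as b) → map (k +_) (x ∷ as) ++ w ≢ map (l +_) b ++ w′
clashAt-sound {k} {l} e x as (z ∷ bs) {w} {w′} fresh t eq
  with Equivalence.to (T-∨ {x = mismatch x z as bs}) t
... | inj₁ t′ = mismatch-sound as bs (List.∷-injectiveˡ eq) t′ (List.∷-injectiveʳ eq)
... | inj₂ t′ with All.lookupAny fresh (Any.any⁻ _ e t′)
...   | ∉rest , t″ with find (Any.any⁻ _ bs t″)
...     | b , b∈bs , yz≡bx =
  ∉rest (subst₂ _∈_ (sym ky≡lb) (sym eq) (∈-++⁺ˡ (there (∈-map⁺ (l +_) b∈bs))))
  where
  y = Any.lookup (Any.any⁻ _ e t′)
  shuffle : ∀ p q r → (p + q) + r ≡ (p + r) + q
  shuffle = solve-∀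
  ky≡lb : k + y ≡ l + b
  ky≡lb = ℕ.+-cancelʳ-≡ z (k + y) (l + b) (begin
    (k + y) + z   ≡⟨ ℕ.+-assoc k y z ⟩
    k + (y + z)   ≡⟨ cong (k +_) (ℕ.≡ᵇ⇒≡ _ _ yz≡bx) ⟩
    k + (b + x)   ≡⟨ cong (k +_) (ℕ.+-comm b x) ⟩
    k + (x + b)   ≡⟨ ℕ.+-assoc k x b ⟨
    (k + x) + b   ≡⟨ cong (_+ b) (List.∷-injectiveˡ eq) ⟩
    (l + z) + b   ≡⟨ shuffle l z b ⟩
    (l + b) + z   ∎)
    where open ≡-Reasoning

-- Entries of `a` move into `e` while `u′` is consumed. If `u′` ends first, the second copy starts
-- inside the first, which `clashAt` refutes; if `a` ends first, the rest of `u′` is the gap `m`.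
clash-sound : ∀ {k l} e a b {w w′} u′ → Unique (map (k +_) a ++ w) →
              All (λ y → k + y ∉ map (k +_) a ++ w) e → T (clash e a b) →
              map (k +_) a ++ w ≡ u′ ++ map (l +_) b ++ w′ →
              ∃[ m ] w ≡ m ++ map (l +_) b ++ w′
clash-sound e []       b u′       _       _     _ eq = u′ , eq
clash-sound e (x ∷ as) b []       _       fresh t eq =
  contradiction eq (clashAt-sound e x as b fresh (proj₁ (Equivalence.to T-∧ t)))
clash-sound e (x ∷ as) b (_ ∷ u′) (p ∷ u) fresh t eq =
  clash-sound (x ∷ e) as b u′ u
    ((λ i → All.lookup p i refl) ∷ All.map (λ ∉rest i → ∉rest (there i)) fresh)
    (proj₂ (Equivalence.to (T-∧ {x = clashAt e x as b}) t)) (List.∷-injectiveʳ eq)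

-- Both prefixes are stripped in step until one copy starts; `clash` in that direction pushes the
-- other copy beyond its end.
disjoint-copies : ∀ {a b π} → T (clash [] a b) → T (clash [] b a) → Unique π →
                  Occurs a π → Occurs b π → Paired a b π ⊎ Paired b a π
disjoint-copies {a} {b} ab ba uniq (u , k , w , refl) (u′ , l , w′ , eq) = go u u′ uniq eq
  where
  prepend : ∀ a b {π} y → Paired a b π → Paired a b (y ∷ π)
  prepend a b y (u , k , m , l , w , refl) = y ∷ u , k , m , l , w , refl
  go : ∀ u u′ → Unique (u ++ map (k +_) a ++ w) →
       u ++ map (k +_) a ++ w ≡ u′ ++ map (l +_) b ++ w′ →
       Paired a b (u ++ map (k +_) a ++ w) ⊎ Paired b a (u ++ map (k +_) a ++ w)
  go [] u′ uniq eq with clash-sound [] a b u′ uniq [] ab eq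
  ... | m , refl = inj₁ ([] , k , m , l , w′ , refl)
  go u@(_ ∷ _) [] uniq eq with clash-sound [] b a u (subst Unique eq uniq) [] ba (sym eq)
  ... | m , refl = inj₂ ([] , l , m , k , w , eq)
  go (y ∷ u) (_ ∷ u′) (_ ∷ uniq) eq =
    Sum.map (prepend a b y) (prepend b a y) (go u u′ uniq (List.∷-injectiveʳ eq))

-- The search behind a certificate

-- One pair of flags for each annihilating pair (x , y): whether x, and whether y, is known to occur in ρ.
Features : Set
Features = List (Bool × Bool)

merge : Features → Features → Features
merge = zipWith λ (x , y) (x′ , y′) → x ∨ x′ , y ∨ y′

conflict : Features → Bool
conflict = any λ (x , y) → x ∧ y

-- What an embedding with block patterns p and q shows about ρ: the interval copies it yields, and for each
-- term (c , a , b) whether p ≤ a and q ≤ b, hence ρ ≤ π[a,b].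
Code : ℕ → Set
Code n = Features × Vec Bool n

without : ∀ {n} → List (Code (suc n)) → List (Code n)
without []                        = []
without ((f , true  ∷ us) ∷ qs) = without qs
without ((f , false ∷ us) ∷ qs) = (f , us) ∷ without qs

tails : ∀ {n} → List (Code (suc n)) → List (Code n)
tails = map λ (f , us) → f , Vec.tail us

-- Each remaining term either holds because of the embeddings found so far (ks), or fails and excludes all codes
-- that would make it hold, or holds through a further embedding, whose code is then guessed from the list.
solve : ∀ {n} → Vec ℤ n → ℤ → Features → Vec Bool n → List (Code n) → Bool
solve []       total f []           codes = isYes (total ≟ℤ ℤ.pos 1)
solve (c ∷ cs) total f (true  ∷ ks) codes = solve cs (total +ℤ c) f ks (tails codes)
solve (c ∷ cs) total f (false ∷ ks) codes =
  solve cs total f ks (without codes) ∧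
  all (λ { (g , false ∷ us) → true
         ; (g , true  ∷ us) → conflict (merge f g) ∨
             solve cs (total +ℤ c) (merge f g) (Vec.zipWith _∨_ ks us) (tails codes) }) codes

-- Every pattern has at least one embedding, so the search starts from the code of one, tried over
-- the whole list.
solveAll : ∀ {n} → Vec ℤ n → List (Code n) → Bool
solveAll cs codes = all (λ (f , us) → conflict f ∨ solve cs (ℤ.pos 0) f us codes) codes

weight : ∀ {n} → Vec ℤ n → Vec Bool n → ℤ
weight []       []       = ℤ.pos 0
weight (c ∷ cs) (b ∷ bs) = (if b then c else ℤ.pos 0) +ℤ weight cs bs

_⊑_ : ∀ {n} → Vec Bool n → Vec Bool n → Set
_⊑_ = VecPointwise _≤ᵇ_

∨-lub : ∀ {x y z} → x ≤ᵇ z → y ≤ᵇ z → x ∨ y ≤ᵇ z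
∨-lub {false} _   q = q
∨-lub {true}  b≤b _ = b≤b

⊑-∨ : ∀ {n} {ks us v : Vec Bool n} → ks ⊑ v → us ⊑ v → Vec.zipWith _∨_ ks us ⊑ v
⊑-∨ []       []       = []
⊑-∨ (p ∷ ps) (q ∷ qs) = ∨-lub p q ∷ ⊑-∨ ps qs

∈-without : ∀ {n} {f} {us : Vec Bool n} {codes} → (f , false ∷ us) ∈ codes → (f , us) ∈ without codes
∈-without (here refl)                          = here refl
∈-without {codes = (_ , true  ∷ _) ∷ _} (there i) = ∈-without i
∈-without {codes = (_ , false ∷ _) ∷ _} (there i) = there (∈-without i)

module _ (Ok : Features → Set)
         (Ok-merge : ∀ {f g} → Ok f → Ok g → Ok (merge f g))
         (Ok-conflict : ∀ {f} → Ok f → ¬ T (conflict f)) where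

  -- Ties the search to one fixed pattern: `Real` holds of the codes of its embeddings, and `v`
  -- tells which terms hold. `bounded` justifies discarding codes when a term fails, `complete`
  -- justifies guessing a code when it holds.
  record Covers {n} (Real : Code n → Set) (v : Vec Bool n) (codes : List (Code n)) : Set where
    field
      ok       : ∀ {f us} → Real (f , us) → Ok f
      bounded  : ∀ {f us} → Real (f , us) → us ⊑ v
      complete : ∀ i → Vec.lookup v i ≡ true →
                 ∃[ f ] ∃[ us ] Real (f , us) × (f , us) ∈ codes × Vec.lookup us i ≡ true
  open Covers

  Tail : ∀ {n} → (Code (suc n) → Set) → Code n → Set
  Tail Real (f , us) = ∃[ b ] Real (f , b ∷ us)

  covers-tails : ∀ {n Real b} {v : Vec Bool n} {codes} →
                 Covers Real (b ∷ v) codes → Covers (Tail Real) v (tails codes)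
  covers-tails C .ok (_ , r) = C .ok r
  covers-tails C .bounded (_ , r) with C .bounded r
  ... | _ ∷ p = p
  covers-tails C .complete i vi with C .complete (suc i) vi
  ... | f , b ∷ us , r , q∈ , ui = f , us , (b , r) , ∈-map⁺ _ q∈ , ui

  covers-without : ∀ {n Real} {v : Vec Bool n} {codes} →
                   Covers Real (false ∷ v) codes → Covers (Tail Real) v (without codes)
  covers-without C .ok (_ , r) = C .ok r
  covers-without C .bounded (_ , r) with C .bounded r
  ... | _ ∷ p = p
  covers-without C .complete i vi with C .complete (suc i) vi
  ... | f , b ∷ us , r , q∈ , ui with C .bounded r
  ...   | b≤b ∷ _ = f , us , (b , r) , ∈-without q∈ , ui

  -- Throughout, `total` is the weight of the terms already decided and `ks` lies below the true
  -- vector, so a term known to hold cannot fail. If a term holds without being known to, `complete`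
  -- selects the branch to follow.
  solve-sound : ∀ {n Real} {v : Vec Bool n} {codes} cs total f ks → Covers Real v codes →
                Ok f → ks ⊑ v → T (solve cs total f ks codes) → total +ℤ weight cs v ≡ ℤ.pos 1
  solve-sound [] total f [] C okf [] t = trans (ℤ.+-identityʳ total) (toWitness t)
  solve-sound {v = true ∷ v} (c ∷ cs) total f (true ∷ ks) C okf (b≤b ∷ le) t =
    trans (sym (ℤ.+-assoc total c _)) (solve-sound cs (total +ℤ c) f ks (covers-tails C) okf le t)
  solve-sound {v = false ∷ v} (c ∷ cs) total f (false ∷ ks) C okf (b≤b ∷ le) t =
    trans (cong (total +ℤ_) (ℤ.+-identityˡ _))
      (solve-sound cs total f ks (covers-without C) okf le (proj₁ (Equivalence.to T-∧ t)))
  solve-sound {v = true ∷ v} {codes} (c ∷ cs) total f (false ∷ ks) C okf (f≤t ∷ le) t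
    with C .complete zero refl
  ... | g , true ∷ us , r , q∈ , refl
    with Equivalence.to T-∨ (All.lookup
      (All.all⁺ _ codes (proj₂ (Equivalence.to (T-∧ {x = solve cs total f ks (without codes)}) t))) q∈)
  ...   | inj₁ bad = contradiction bad (Ok-conflict (Ok-merge okf (C .ok r)))
  ...   | inj₂ t′ with C .bounded r
  ...     | _ ∷ le′ = trans (sym (ℤ.+-assoc total c _))
      (solve-sound cs (total +ℤ c) (merge f g) _ (covers-tails C) (Ok-merge okf (C .ok r)) (⊑-∨ le le′) t′)

  solveAll-sound : ∀ {n Real} {v : Vec Bool n} {codes f us} cs → Covers Real v codes →
                   Real (f , us) → (f , us) ∈ codes → T (solveAll cs codes) → weight cs v ≡ ℤ.pos 1
  solveAll-sound {codes = codes} {f} {us} cs C r q∈ t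
    with Equivalence.to T-∨ (All.lookup (All.all⁺ _ codes t) q∈)
  ... | inj₁ bad = contradiction bad (Ok-conflict (C .ok r))
  ... | inj₂ t′ = trans (sym (ℤ.+-identityˡ _)) (solve-sound cs (ℤ.pos 0) f us C (C .ok r) (C .bounded r) t′)

-- Words with two blocks

-- The second half makes a copy exhaust its range of values, so no other entry of a duplicate-free
-- word falls inside that range.
Block : List ℕ → Set
Block φ = All (InBlock (length φ)) φ × All (λ x → suc x ∈ φ) (upTo (length φ))

block? : ∀ φ → Dec (Block φ)
block? φ =
  All.all? (λ x → (1 ≤? x) ×-dec (x ≤? length φ)) φ ×-dec All.all? (λ x → suc x ∈ℕ? φ) (upTo (length φ))

Unique-++⇒∉ : ∀ {y : ℕ} s {t} → Unique (s ++ t) → y ∈ s → y ∉ t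
Unique-++⇒∉ (x ∷ s) (p ∷ _) (here refl) j = All.lookup p (∈-++⁺ʳ s j) refl
Unique-++⇒∉ (x ∷ s) (_ ∷ u) (there i)   j = Unique-++⇒∉ s u i j

Unique-++⁻ʳ : ∀ (s : List ℕ) {t} → Unique (s ++ t) → Unique t
Unique-++⁻ʳ []      u       = u
Unique-++⁻ʳ (_ ∷ s) (_ ∷ u) = Unique-++⁻ʳ s u

outside : ∀ {k φ y} → Block φ → y ∉ map (k +_) φ → Outside k (length φ) y
outside {k} {φ} {y} (_ , full) y∉ with y ≤? k | k + length φ <? y
... | yes p | _     = inj₁ p
... | no  _ | yes q = inj₂ q
... | no ¬p | no ¬q =
  contradiction (subst (_∈ map (k +_) φ) eq (∈-map⁺ (k +_) (All.lookup full (∈-upTo⁺ x<n)))) y∉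
  where
  k<y = ℕ.≰⇒> ¬p
  x = y ∸ suc k
  eq : k + suc x ≡ y
  eq = trans (ℕ.+-suc k x) (ℕ.m+[n∸m]≡n k<y)
  x<n : x < length φ
  x<n = ℕ.+-cancelˡ-≤ k _ _ (subst (_≤ k + length φ) (sym eq) (ℕ.≮⇒≥ ¬q))

Unique⇒outside : ∀ {k φ} s t → Block φ → Unique (s ++ map (k +_) φ ++ t) →
                 All (Outside k (length φ)) s × All (Outside k (length φ)) t
Unique⇒outside {k} {φ} s t B u =
  All.tabulate (λ i → outside B (λ j → Unique-++⇒∉ s u i (∈-++⁺ˡ j))) ,
  All.tabulate (λ i → outside B (λ j → Unique-++⇒∉ (map (k +_) φ) (Unique-++⁻ʳ s u) j i))

word-assoc : ∀ u k a m l b w → word u k a m l b w ≡ (u ++ map (k +_) a ++ m) ++ map (l +_) b ++ w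
word-assoc u k a m l b w = sym (trans (List.++-assoc u _ _) (cong (u ++_) (List.++-assoc (map (k +_) a) m _)))

length-word : ∀ u k a m l b w → length (word u k a m l b w) ≡
              (length u + length m + length w) + (length a + length b)
length-word u k a m l b w
  rewrite List.length-++ u {map (k +_) a ++ m ++ map (l +_) b ++ w}
        | List.length-++ (map (k +_) a) {m ++ map (l +_) b ++ w}
        | List.length-++ m {map (l +_) b ++ w}
        | List.length-++ (map (l +_) b) {w}
        | List.length-map (k +_) a | List.length-map (l +_) b =
  shuffle (length u) (length a) (length m) (length b) (length w)
  where
  shuffle : ∀ u a m b w → u + (a + (m + (b + w))) ≡ (u + m + w) + (a + b)
  shuffle = solve-∀

word-⊆ : ∀ {u u′ k a a′ m m′ l b b′ w w′} → u′ ⊆ u → a′ ⊆ a → m′ ⊆ m → b′ ⊆ b → w′ ⊆ w →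
         word u′ k a′ m′ l b′ w′ ⊆ word u k a m l b w
word-⊆ {k = k} {l = l} pu pa pm pb pw =
  ⊆-++⁺ pu (⊆-++⁺ (⊆-map⁺ (k +_) pa) (⊆-++⁺ pm (⊆-++⁺ (⊆-map⁺ (l +_) pb) pw)))

module TwoBlocks (φ ψ : List ℕ) (Bφ : Block φ) (Bψ : Block ψ)
                 (u : List ℕ) (k : ℕ) (m : List ℕ) (l : ℕ) (w : List ℕ)
                 (unique : Unique (word u k φ m l ψ w)) where

  inflated : List ℕ → List ℕ → List ℕ
  inflated a b = word u k a m l b w

  record Embeds (ρ p q : List ℕ) : Set where
    constructor embeds
    field
      {u′ c m′ d w′} : List ℕ
      u′⊆u : u′ ⊆ u
      c⊆φ  : c ⊆ φ
      m′⊆m : m′ ⊆ m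
      d⊆ψ  : d ⊆ ψ
      w′⊆w : w′ ⊆ w
      p≡   : p ≡ st c
      q≡   : q ≡ st d
      ρ≡   : ρ ≡ st (word u′ k c m′ l d w′)

  module _ {u′ c m′ d w′} (u′⊆u : u′ ⊆ u) (c⊆φ : c ⊆ φ) (m′⊆m : m′ ⊆ m) (d⊆ψ : d ⊆ ψ) (w′⊆w : w′ ⊆ w) where

    out-φ : All (Outside k (length φ)) u′ × All (Outside k (length φ)) (m′ ++ map (l +_) d ++ w′)
    out-φ with Unique⇒outside u _ Bφ unique
    ... | ou , ow = All-resp-⊆ u′⊆u ou , All-resp-⊆ (⊆-++⁺ m′⊆m (⊆-++⁺ (⊆-map⁺ (l +_) d⊆ψ) w′⊆w)) ow

    out-ψ : All (Outside l (length ψ)) (u′ ++ map (k +_) c ++ m′) × All (Outside l (length ψ)) w′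
    out-ψ with Unique⇒outside _ w Bψ (subst Unique (word-assoc u k φ m l ψ w) unique)
    ... | ou , ow = All-resp-⊆ (⊆-++⁺ u′⊆u (⊆-++⁺ (⊆-map⁺ (k +_) c⊆φ) m′⊆m)) ou , All-resp-⊆ w′⊆w ow

    in-φ : All (InBlock (length φ)) c
    in-φ = All-resp-⊆ c⊆φ (proj₁ Bφ)

    in-ψ : All (InBlock (length ψ)) d
    in-ψ = All-resp-⊆ d⊆ψ (proj₁ Bψ)

  -- The blocks are exchanged one at a time, each being part of the context of the other.
  st-word-cong : ∀ {u′ c m′ d w′ c₀ d₀} → u′ ⊆ u → c ⊆ φ → m′ ⊆ m → d ⊆ ψ → w′ ⊆ w → c₀ ⊆ φ → d₀ ⊆ ψ →
                 st c ≡ st c₀ → st d ≡ st d₀ → st (word u′ k c m′ l d w′) ≡ st (word u′ k c₀ m′ l d₀ w′)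
  st-word-cong {u′} {c} {m′} {d} {w′} {c₀} {d₀} pu pc pm pd pw pc₀ pd₀ ceq deq = begin
    st (word u′ k c m′ l d w′)
      ≡⟨ uncurry (st-block-cong k u′ _) (out-φ pu pc pm pd pw)
           (in-φ pu pc pm pd pw) (in-φ pu pc₀ pm pd pw) ceq ⟩
    st (word u′ k c₀ m′ l d w′)
      ≡⟨ cong st (word-assoc u′ k c₀ m′ l d w′) ⟩
    st ((u′ ++ map (k +_) c₀ ++ m′) ++ map (l +_) d ++ w′)
      ≡⟨ uncurry (st-block-cong l _ w′) (out-ψ pu pc₀ pm pd pw)
           (in-ψ pu pc₀ pm pd pw) (in-ψ pu pc₀ pm pd₀ pw) deq ⟩
    st ((u′ ++ map (k +_) c₀ ++ m′) ++ map (l +_) d₀ ++ w′)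
      ≡⟨ cong st (word-assoc u′ k c₀ m′ l d₀ w′) ⟨
    st (word u′ k c₀ m′ l d₀ w′) ∎
    where open ≡-Reasoning

  occursˡ : ∀ {ρ p q} → Embeds ρ p q → Occurs p ρ
  occursˡ (embeds pu pc pm pd pw refl refl refl) =
    uncurry Occurs-st (out-φ pu pc pm pd pw) (in-φ pu pc pm pd pw)

  occursʳ : ∀ {ρ p q} → Embeds ρ p q → Occurs q ρ
  occursʳ (embeds {u′} {c} {m′} {d} {w′} pu pc pm pd pw refl refl refl) =
    subst (λ z → Occurs (st d) (st z)) (sym (word-assoc u′ k c m′ l d w′))
      (uncurry Occurs-st (out-ψ pu pc pm pd pw) (in-ψ pu pc pm pd pw))

  pattern⇒embeds : ∀ {a b s} → a ⊆ φ → b ⊆ ψ → s ⊆ inflated a b →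
                   ∃[ p ] ∃[ q ] Embeds (st s) p q × p ∈ patterns a × q ∈ patterns b
  pattern⇒embeds {a} {b} a⊆φ b⊆ψ s⊆ with ⊆-++⁻ u s⊆
  ... | u′ , _ , refl , pu , s⊆ with ⊆-++⁻ (map (k +_) a) s⊆
  ... | _ , _ , refl , pa , s⊆ with ⊆-map⁻ a pa | ⊆-++⁻ m s⊆
  ... | c , pc , refl | m′ , _ , refl , pm , s⊆ with ⊆-++⁻ (map (l +_) b) s⊆
  ... | _ , w′ , refl , pb , pw with ⊆-map⁻ b pb
  ... | d , pd , refl =
    st c , st d ,
    embeds pu (⊆-trans pc a⊆φ) pm (⊆-trans pd b⊆ψ) pw refl refl refl ,
    ∈-patterns⁺ pc , ∈-patterns⁺ pd

  -- The embedding may use entries outside `a` and `b`, but its block patterns have copies `c₀` and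
  -- `d₀` there; exchanging them preserves ρ.
  embeds⇒pattern : ∀ {a b ρ p q} → a ⊆ φ → b ⊆ ψ → Embeds ρ p q → p ∈ patterns a → q ∈ patterns b →
                   ρ ∈ patterns (inflated a b)
  embeds⇒pattern {a} {b} a⊆φ b⊆ψ (embeds pu pc pm pd pw refl refl refl) p∈ q∈
    with ∈-patterns⁻ a p∈ | ∈-patterns⁻ b q∈
  ... | c₀ , c₀⊆a , ceq | d₀ , d₀⊆b , deq =
    subst (_∈ patterns (inflated a b))
      (sym (st-word-cong pu pc pm pd pw (⊆-trans c₀⊆a a⊆φ) (⊆-trans d₀⊆b b⊆ψ) ceq deq))
      (∈-patterns⁺ (word-⊆ pu c₀⊆a pm d₀⊆b pw))

-- The annihilation criterion

Zeros : Set
Zeros = List (List ℕ × List ℕ)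

Term : Set
Term = ℤ × List ℕ × List ℕ

features : Zeros → List ℕ → List ℕ → Features
features zs p q = map (λ (x , y) → occursᵇ x p ∨ occursᵇ x q , occursᵇ y p ∨ occursᵇ y q) zs

dominates : List ℕ → List ℕ → Term → Bool
dominates p q (_ , a , b) = does (p ∈? patterns a) ∧ does (q ∈? patterns b)

code : ∀ {n} → Zeros → Vec Term n → List ℕ → List ℕ → Code n
code zs ts p q = features zs p q , Vec.map (dominates p q) ts

codes : ∀ {n} → Zeros → Vec Term n → List ℕ → List ℕ → List (Code n)
codes zs ts φ ψ =
  cartesianProductWith (code zs ts) (deduplicate _≟ᴸ_ (patterns φ)) (deduplicate _≟ᴸ_ (patterns ψ))

-- The length bounds make the sum for π[a,b] vanish: at least two entries for the recursion to
-- apply, and fewer than π so that its patterns are proper ones of π.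
Proper : List ℕ → List ℕ → Term → Set
Proper φ ψ (_ , a , b) =
  a ∈ subseqs φ × b ∈ subseqs ψ × 2 ≤ length a + length b × length a + length b < length φ + length ψ

proper? : ∀ φ ψ t → Dec (Proper φ ψ t)
proper? φ ψ (_ , a , b) =
  (a ∈? subseqs φ) ×-dec (b ∈? subseqs ψ) ×-dec
  (2 ≤? length a + length b) ×-dec (length a + length b <? length φ + length ψ)

-- On concrete data every field computes to the unit type, so a certificate is written `_` and
-- checking it runs the search.
record Certificate (zs : Zeros) {n} (ts : Vec Term n) (φ ψ : List ℕ) : Set where
  constructor certificate
  field
    blockˡ : True (block? φ)
    blockʳ : True (block? ψ)
    large  : True (2 ≤? length φ + length ψ)
    proper : True (VecAll.all? (proper? φ ψ) ts)
    solved : T (solveAll (Vec.map proj₁ ts) (codes zs ts φ ψ))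

Records : List ℕ → Zeros → Features → Set
Records ρ = Pointwise λ (x , y) (b , b′) → (T b → Occurs x ρ) × (T b′ → Occurs y ρ)

records-merge : ∀ {ρ zs f g} → Records ρ zs f → Records ρ zs g → Records ρ zs (merge f g)
records-merge []               []                 = []
records-merge ((x , y) ∷ rs) ((x′ , y′) ∷ rs′) =
  ([ x , x′ ]′ ∘ Equivalence.to T-∨ , [ y , y′ ]′ ∘ Equivalence.to T-∨) ∷ records-merge rs rs′

records-conflict : ∀ {ρ zs f} → Records ρ zs f → T (conflict f) →
                   ∃[ x ] ∃[ y ] (x , y) ∈ zs × Occurs x ρ × Occurs y ρ
records-conflict {f = (b , b′) ∷ f} (r ∷ rs) t with Equivalence.to (T-∨ {x = b ∧ b′}) t
... | inj₁ both with Equivalence.to T-∧ both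
...   | tb , tb′ = _ , _ , here refl , proj₁ r tb , proj₂ r tb′
records-conflict (r ∷ rs) t | inj₂ t′ with records-conflict rs t′
...   | x , y , i , o , o′ = x , y , there i , o , o′

records-features : ∀ {ρ p q} zs → Occurs p ρ → Occurs q ρ → Records ρ zs (features zs p q)
records-features []       _ _ = []
records-features {ρ} {p} {q} ((x , y) ∷ zs) op oq = (found x , found y) ∷ records-features zs op oq
  where
  found : ∀ x → T (occursᵇ x p ∨ occursᵇ x q) → Occurs x ρ
  found x = [ (λ t → Occurs-trans (occursᵇ-sound x p t) op) , (λ t → Occurs-trans (occursᵇ-sound x q t) oq) ]′
            ∘ Equivalence.to T-∨

module _ {n} (zs : Zeros) (ts : Vec Term n) {φ ψ : List ℕ} (cert : Certificate zs ts φ ψ) where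
  open Certificate cert

  -- `zero-below` carries both the known pairs and the induction hypothesis; it is what allows the
  -- search to discard conflicts.
  M-word : ∀ u k m l w → Unique (word u k φ m l ψ w) →
           (∀ {ρ x y} → Unique ρ → length ρ < length (word u k φ m l ψ w) →
              (x , y) ∈ zs → Occurs x ρ → Occurs y ρ → M ρ ≡ ℤ.pos 0) →
           M (word u k φ m l ψ w) ≡ ℤ.pos 0
  M-word u k m l w unique zero-below = begin
    M π                                ≡⟨ ℤ.+-identityʳ (M π) ⟨
    M π +ℤ ℤ.pos 0                      ≡⟨ cong (M π +ℤ_) Σ≡0 ⟨
    M π +ℤ Σ[ M ] (properPatterns π)   ≡⟨ Σ-properPatterns π π-large ⟩
    ℤ.pos 0                            ∎
    where
    open ≡-Reasoning
    open TwoBlocks φ ψ (toWitness blockˡ) (toWitness blockʳ) u k m l w unique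
    π = word u k φ m l ψ w

    π-large : 2 ≤ length π
    π-large = subst (2 ≤_) (sym (length-word u k φ m l ψ w))
      (ℕ.≤-trans (toWitness large) (ℕ.m≤n+m _ (length u + length m + length w)))

    contained : ∀ {n} → List ℕ → Vec Term n → Vec Bool n
    contained ρ = Vec.map λ (_ , a , b) → does (ρ ∈? patterns (inflated a b))

    -- By linearity each term contributes `c` times the sum of `M` over the patterns of π[a,b],
    -- which `Σ-patterns` shows to be 0.
    Σ-contained : ∀ {n} {ts : Vec Term n} → VecAll (Proper φ ψ) ts →
      Σ[ (λ ρ → weight (Vec.map proj₁ ts) (contained ρ ts) *ℤ M ρ) ] (properPatterns π) ≡ ℤ.pos 0
    Σ-contained {ts = []} [] = Σ-* (ℤ.pos 0) M (properPatterns π)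
    Σ-contained {ts = (c , a , b) ∷ ts} ((a∈ , b∈ , two , lt) ∷ rest) = begin
      Σ[ (λ ρ → ((if δ ρ then c else ℤ.pos 0) +ℤ r ρ) *ℤ M ρ) ] (properPatterns π)
        ≡⟨ Σ-cong (properPatterns π) (λ {ρ} _ → distrib (δ ρ) (r ρ) (M ρ)) ⟩
      Σ[ (λ ρ → c *ℤ (if δ ρ then M ρ else ℤ.pos 0) +ℤ r ρ *ℤ M ρ) ] (properPatterns π)
        ≡⟨ Σ-+ _ (λ ρ → r ρ *ℤ M ρ) (properPatterns π) ⟩
      Σ[ (λ ρ → c *ℤ (if δ ρ then M ρ else ℤ.pos 0)) ] (properPatterns π) +ℤ
      Σ[ (λ ρ → r ρ *ℤ M ρ) ] (properPatterns π)
        ≡⟨ cong₂ _+ℤ_ (Σ-* c _ (properPatterns π)) (Σ-contained rest) ⟩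
      c *ℤ Σ[ (λ ρ → if δ ρ then M ρ else ℤ.pos 0) ] (properPatterns π) +ℤ ℤ.pos 0
        ≡⟨ ℤ.+-identityʳ _ ⟩
      c *ℤ Σ[ (λ ρ → if δ ρ then M ρ else ℤ.pos 0) ] (properPatterns π)
        ≡⟨ cong (c *ℤ_) (Σ-patterns sub shorter x-large) ⟩
      c *ℤ ℤ.pos 0
        ≡⟨ ℤ.*-zeroʳ c ⟩
      ℤ.pos 0 ∎
      where
      δ : List ℕ → Bool
      δ ρ = does (ρ ∈? patterns (inflated a b))
      r : List ℕ → ℤ
      r ρ = weight (Vec.map proj₁ ts) (contained ρ ts)
      distrib : ∀ d s z → ((if d then c else ℤ.pos 0) +ℤ s) *ℤ z ≡ c *ℤ (if d then z else ℤ.pos 0) +ℤ s *ℤ z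
      distrib true  s z = ℤ.*-distribʳ-+ z c s
      distrib false s z = trans (cong (_*ℤ z) (ℤ.+-identityˡ s))
        (sym (trans (cong (_+ℤ s *ℤ z) (ℤ.*-zeroʳ c)) (ℤ.+-identityˡ (s *ℤ z))))
      sub : inflated a b ⊆ π
      sub = word-⊆ (⊆-refl {x = u}) (∈-subseqs⇒⊆ φ a∈) (⊆-refl {x = m}) (∈-subseqs⇒⊆ ψ b∈) (⊆-refl {x = w})
      shorter : length (inflated a b) < length π
      shorter rewrite length-word u k a m l b w | length-word u k φ m l ψ w =
        ℕ.+-monoʳ-< (length u + length m + length w) lt
      x-large : 2 ≤ length (inflated a b)
      x-large rewrite length-word u k a m l b w =
        ℕ.≤-trans two (ℕ.m≤n+m _ (length u + length m + length w))

    module _ {s} (s⊆π : s ⊆ π) (s<π : length s < length π) (s-nonzero : M (st s) ≢ ℤ.pos 0) where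

      Realised : Code n → Set
      Realised c = ∃[ p ] ∃[ q ] c ≡ code zs ts p q × Embeds (st s) p q

      no-conflict : ∀ {f} → Records (st s) zs f → ¬ T (conflict f)
      no-conflict r t with records-conflict r t
      ... | x , y , i , ox , oy = s-nonzero (zero-below (st-unique (⊆-Unique s⊆π unique))
        (subst (_< length π) (sym (length-st s)) s<π) i ox oy)

      dominates-sound : ∀ {p q n} {ts : Vec Term n} → Embeds (st s) p q → VecAll (Proper φ ψ) ts →
                        Vec.map (dominates p q) ts ⊑ contained (st s) ts
      dominates-sound e [] = []
      dominates-sound {p} {q} {ts = (_ , a , b) ∷ _} e ((a∈ , b∈ , _) ∷ rest) =
        head (p ∈? patterns a) (q ∈? patterns b) ∷ dominates-sound e rest
        where
        head : (d : Dec (p ∈ patterns a)) (d′ : Dec (q ∈ patterns b)) →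
               does d ∧ does d′ ≤ᵇ does (st s ∈? patterns (inflated a b))
        head (yes p∈) (yes q∈) rewrite dec-true (st s ∈? patterns (inflated a b))
          (embeds⇒pattern (∈-subseqs⇒⊆ φ a∈) (∈-subseqs⇒⊆ ψ b∈) e p∈ q∈) = b≤b
        head (yes _) (no _) = ≤ᵇ-minimum _
        head (no _)  _      = ≤ᵇ-minimum _

      code∈codes : ∀ {a b p q} → a ⊆ φ → b ⊆ ψ → p ∈ patterns a → q ∈ patterns b →
                   code zs ts p q ∈ codes zs ts φ ψ
      code∈codes {a} {b} a⊆φ b⊆ψ p∈ q∈ =
        ∈-cartesianProductWith⁺ (code zs ts) (listed a⊆φ p∈) (listed b⊆ψ q∈)
        where
        listed : ∀ {a φ p} → a ⊆ φ → p ∈ patterns a → p ∈ deduplicate _≟ᴸ_ (patterns φ)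
        listed {a} a⊆φ p∈ with ∈-patterns⁻ a p∈
        ... | c , c⊆a , refl = ∈-deduplicate⁺ _≟ᴸ_ (∈-patterns⁺ (⊆-trans c⊆a a⊆φ))

      realise : ∀ {n} {ts′ : Vec Term n} i → VecAll (Proper φ ψ) ts′ →
                Vec.lookup (contained (st s) ts′) i ≡ true →
                ∃[ p ] ∃[ q ] Embeds (st s) p q × code zs ts p q ∈ codes zs ts φ ψ ×
                              Vec.lookup (Vec.map (dominates p q) ts′) i ≡ true
      realise {ts′ = (_ , a , b) ∷ _} zero ((a∈ , b∈ , _) ∷ _) vi
        with ∈-patterns⁻ (inflated a b) (does⇒ (st s ∈? patterns (inflated a b)) vi)
      ... | s′ , s′⊆ , eq with pattern⇒embeds (∈-subseqs⇒⊆ φ a∈) (∈-subseqs⇒⊆ ψ b∈) s′⊆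
      ... | p , q , e , p∈ , q∈ =
        p , q , subst (λ ρ → Embeds ρ p q) (sym eq) e ,
        code∈codes (∈-subseqs⇒⊆ φ a∈) (∈-subseqs⇒⊆ ψ b∈) p∈ q∈ ,
        cong₂ _∧_ (dec-true (p ∈? patterns a) p∈) (dec-true (q ∈? patterns b) q∈)
      realise (suc i) (_ ∷ rest) vi = realise i rest vi

      covers : Covers (Records (st s) zs) records-merge no-conflict Realised
                 (contained (st s) ts) (codes zs ts φ ψ)
      covers .Covers.ok (p , q , refl , e) = records-features zs (occursˡ e) (occursʳ e)
      covers .Covers.bounded (p , q , refl , e) = dominates-sound e (toWitness proper)
      covers .Covers.complete i vi with realise i (toWitness proper) vi
      ... | p , q , e , c∈ , di = _ , _ , (p , q , refl , e) , c∈ , di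

      weight≡1 : weight (Vec.map proj₁ ts) (contained (st s) ts) ≡ ℤ.pos 1
      -- π is itself π[φ,ψ], so `s` yields the embedding whose code starts the search.
      weight≡1 with pattern⇒embeds ⊆-refl ⊆-refl s⊆π
      ... | p , q , e , p∈ , q∈ =
        solveAll-sound _ records-merge no-conflict (Vec.map proj₁ ts) covers
          (p , q , refl , e) (code∈codes ⊆-refl ⊆-refl p∈ q∈) solved

    weighted : ∀ {ρ} → ρ ∈ properPatterns π → M ρ ≡ weight (Vec.map proj₁ ts) (contained ρ ts) *ℤ M ρ
    weighted {ρ} ρ∈ with ∈-properPatterns⁻ π ρ∈
    ... | s , s⊆π , s<π , refl with M (st s) ≟ℤ ℤ.pos 0
    ...   | yes eq = trans eq (sym (trans (cong (W *ℤ_) eq) (ℤ.*-zeroʳ W)))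
      where W = weight (Vec.map proj₁ ts) (contained (st s) ts)
    ...   | no neq = sym (trans (cong (_*ℤ M (st s)) (weight≡1 s⊆π s<π neq)) (ℤ.*-identityˡ _))

    Σ≡0 : Σ[ M ] (properPatterns π) ≡ ℤ.pos 0
    Σ≡0 = trans (Σ-cong (properPatterns π) weighted) (Σ-contained (toWitness proper))

-- Annihilator pairs

Annihilates : List ℕ → List ℕ → Set
Annihilates x y = ∀ {ρ} → Unique ρ → Occurs x ρ → Occurs y ρ → M ρ ≡ ℤ.pos 0

flip-blocks : ∀ {n} → Vec Term n → Vec Term n
flip-blocks = Vec.map (map₂ swap)

-- Strong induction on the length: (φ,ψ) may stand in its own list, being applied only to shorter
-- words. The two certificates serve the two left-to-right orders of the copies.
annihilates : ∀ {n φ ψ} zs (ts : Vec Term n) →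
  Certificate ((φ , ψ) ∷ zs) ts φ ψ → Certificate ((φ , ψ) ∷ zs) (flip-blocks ts) ψ φ →
  (∀ {π} → Unique π → Occurs φ π → Occurs ψ π → Paired φ ψ π ⊎ Paired ψ φ π) →
  All (uncurry Annihilates) zs → Annihilates φ ψ
annihilates {φ = φ} {ψ} zs ts cert cert′ separate known {ρ} = go ρ (<-wellFounded (length ρ))
  where
  go : ∀ π → Acc _<_ (length π) → Unique π → Occurs φ π → Occurs ψ π → M π ≡ ℤ.pos 0
  below-zero : ∀ π → Acc _<_ (length π) → ∀ {ρ x y} → Unique ρ → length ρ < length π →
               (x , y) ∈ (φ , ψ) ∷ zs → Occurs x ρ → Occurs y ρ → M ρ ≡ ℤ.pos 0
  go π rec uniq oφ oψ with separate uniq oφ oψ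
  ... | inj₁ (u , k , m , l , w , refl) = M-word _ ts cert u k m l w uniq (below-zero (word u k φ m l ψ w) rec)
  ... | inj₂ (u , k , m , l , w , refl) =
      M-word _ (flip-blocks ts) cert′ u k m l w uniq (below-zero (word u k ψ m l φ w) rec)
  below-zero π (acc rs) {ρ} uniq lt (here refl) = go ρ (rs lt) uniq
  below-zero π _ uniq lt (there i) = All.lookup known i uniq

-- The empty block is placed at the end of the word; `clash` is of no help for it, since an empty
-- copy can start anywhere.
Occurs⇒Paired-[] : ∀ {a π} → Occurs a π → Paired a [] π
Occurs⇒Paired-[] {a} (u , k , w , refl) =
  u , k , w , 0 , [] , cong (λ z → u ++ map (k +_) a ++ z) (sym (List.++-identityʳ w))

p12 p21 p213 p321 p2143 p2431 : List ℕ
p12   = 1 ∷ 2 ∷ []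
p21   = 2 ∷ 1 ∷ []
p213  = 2 ∷ 1 ∷ 3 ∷ []
p321  = 3 ∷ 2 ∷ 1 ∷ []
p2143 = 2 ∷ 1 ∷ 4 ∷ 3 ∷ []
p2431 = 2 ∷ 4 ∷ 3 ∷ 1 ∷ []

-- The coefficients below come from inclusion–exclusion over the blocks whose adjacencies are all descents and
-- over those whose adjacencies are all ascents: a pattern with both kinds has M = 0.  Small blocks come
-- first, which keeps the search short.
annihilates-12-21 : Annihilates p12 p21
annihilates-12-21 = annihilates [] terms _ _ (disjoint-copies _ _) []
  where
  terms : Vec Term 3
  terms = (-1ℤ , 1 ∷ [] , 1 ∷ []) ∷ (1ℤ , 1 ∷ [] , p21) ∷ (1ℤ , p12 , 1 ∷ []) ∷ []

-- Pairing with the empty block says that 321 annihilates alone. A pattern keeping all of 321 falls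
-- to the induction; any other embedding keeps at most 21 of the block, so one term suffices.
annihilates-321 : Annihilates p321 []
annihilates-321 = annihilates [] terms _ _ (λ _ o _ → inj₁ (Occurs⇒Paired-[] o)) []
  where
  terms : Vec Term 1
  terms = (1ℤ , p21 , []) ∷ []

annihilates-213-2431 : Annihilates p213 p2431
annihilates-213-2431 =
  annihilates ((p12 , p21) ∷ (p321 , []) ∷ []) terms _ _ (disjoint-copies _ _)
    (annihilates-12-21 ∷ annihilates-321 ∷ [])
  where
  terms : Vec Term 7
  -- Blocks are literal subwords, hence 13 and 24 for the pattern 12. For a single embedding, the
  -- last three terms unite (213,132) and (21,2431), the descending cases. The first four add the
  -- ascending case (12,231) minus its overlap with these, made up of (1,231) and (12,12).
  terms = (1ℤ  , 1 ∷ []     , 2 ∷ 4 ∷ [])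
        ∷ (-1ℤ , 1 ∷ []     , 2 ∷ 3 ∷ 1 ∷ [])
        ∷ (-1ℤ , 1 ∷ 3 ∷ [] , 2 ∷ 4 ∷ [])
        ∷ (1ℤ  , 1 ∷ 3 ∷ [] , 2 ∷ 3 ∷ 1 ∷ [])
        ∷ (-1ℤ , p21        , 2 ∷ 4 ∷ 3 ∷ [])
        ∷ (1ℤ  , p213       , 2 ∷ 4 ∷ 3 ∷ [])
        ∷ (1ℤ  , p21        , p2431)
        ∷ []

annihilates-2143-2431 : Annihilates p2143 p2431
annihilates-2143-2431 =
  annihilates ((p12 , p21) ∷ (p321 , []) ∷ (p213 , p2431) ∷ []) terms _ _ (disjoint-copies _ _)
    (annihilates-12-21 ∷ annihilates-321 ∷ annihilates-213-2431 ∷ [])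
  where
  terms : Vec Term 11
  -- For a single embedding, the last seven terms are inclusion-exclusion over (2143,132),
  -- (213,2431) and (132,2431), with 21 as the common part of 213 and 132. But 12 lies below both as
  -- well, so (12,231) is counted twice; the first four terms remove the excess, hence their
  -- reversed signs.
  terms = (-1ℤ , 1 ∷ []         , 2 ∷ 4 ∷ [])
        ∷ (1ℤ  , 1 ∷ []         , 2 ∷ 3 ∷ 1 ∷ [])
        ∷ (1ℤ  , 1 ∷ 4 ∷ []     , 2 ∷ 4 ∷ [])
        ∷ (-1ℤ , 1 ∷ 4 ∷ []     , 2 ∷ 3 ∷ 1 ∷ [])
        ∷ (1ℤ  , p21            , 2 ∷ 4 ∷ 3 ∷ [])
        ∷ (-1ℤ , 2 ∷ 1 ∷ 4 ∷ [] , 2 ∷ 4 ∷ 3 ∷ [])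
        ∷ (-1ℤ , 1 ∷ 4 ∷ 3 ∷ [] , 2 ∷ 4 ∷ 3 ∷ [])
        ∷ (1ℤ  , p2143          , 2 ∷ 4 ∷ 3 ∷ [])
        ∷ (-1ℤ , p21            , p2431)
        ∷ (1ℤ  , 2 ∷ 1 ∷ 4 ∷ [] , p2431)
        ∷ (1ℤ  , 1 ∷ 4 ∷ 3 ∷ [] , p2431)
        ∷ []

-- Inflations

at-injective : ∀ {τ p q} → Unique τ → p < length τ → q < length τ → at τ p ≡ at τ q → p ≡ q
at-injective {τ} {p} {q} = go τ p q
  where
  at∈ : ∀ τ q → q < length τ → at τ q ∈ τ
  at∈ (x ∷ τ) zero    _       = here refl
  at∈ (x ∷ τ) (suc q) (s≤s l) = there (at∈ τ q l)
  go : ∀ τ p q → Unique τ → p < length τ → q < length τ → at τ p ≡ at τ q → p ≡ q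
  go (x ∷ τ) zero    zero    _       _       _       _  = refl
  go (x ∷ τ) zero    (suc q) (f ∷ _) _       (s≤s l) eq = contradiction eq (All.lookup f (at∈ τ q l))
  go (x ∷ τ) (suc p) zero    (f ∷ _) (s≤s l) _       eq = contradiction (sym eq) (All.lookup f (at∈ τ p l))
  go (x ∷ τ) (suc p) (suc q) (_ ∷ u) (s≤s l) (s≤s r) eq = cong suc (go τ p q u l r eq)

sum-map-gap : ∀ {f g : ℕ → ℕ} {s k} xs → (∀ x → f x ≤ g x) → f k + s ≤ g k → k ∈ xs →
              sum (map f xs) + s ≤ sum (map g xs)
sum-map-gap {f} {g} {s} (x ∷ xs) le gap (here refl) = begin
  f x + sum (map f xs) + s    ≡⟨ shuffle (f x) (sum (map f xs)) s ⟩
  f x + s + sum (map f xs)    ≤⟨ ℕ.+-mono-≤ gap (mono xs) ⟩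
  g x + sum (map g xs)        ∎
  where
  open ℕ.≤-Reasoning
  shuffle : ∀ a b c → a + b + c ≡ a + c + b
  shuffle = solve-∀
  mono : ∀ xs → sum (map f xs) ≤ sum (map g xs)
  mono []       = z≤n
  mono (x ∷ xs) = ℕ.+-mono-≤ (le x) (mono xs)
sum-map-gap {f} {g} {s} (x ∷ xs) le gap (there i) = begin
  f x + sum (map f xs) + s    ≡⟨ ℕ.+-assoc (f x) _ s ⟩
  f x + (sum (map f xs) + s)  ≤⟨ ℕ.+-mono-≤ (le x) (sum-map-gap xs le gap i) ⟩
  g x + sum (map g xs)        ∎
  where open ℕ.≤-Reasoning

AllPairs-map∈ : ∀ {R S : ℕ → ℕ → Set} {xs} → (∀ {x y} → x ∈ xs → y ∈ xs → R x y → S x y) →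
                AllPairs R xs → AllPairs S xs
AllPairs-map∈ f []       = []
AllPairs-map∈ f (p ∷ ps) =
  All.tabulate (λ i → f (here refl) (there i) (All.lookup p i)) ∷
  AllPairs-map∈ (λ i j → f (there i) (there j)) ps

<ᵇ-true : ∀ {m n} → m < n → (m <ᵇ n) ≡ true
<ᵇ-true = Equivalence.to T-≡ ∘ ℕ.<⇒<ᵇ

≡ᵇ-refl : ∀ n → (n ≡ᵇ n) ≡ true
≡ᵇ-refl zero    = refl
≡ᵇ-refl (suc n) = ≡ᵇ-refl n

≢⇒≡ᵇ-false : ∀ {m n} → m ≢ n → (m ≡ᵇ n) ≡ false
≢⇒≡ᵇ-false {zero}  {zero}  ne = contradiction refl ne
≢⇒≡ᵇ-false {zero}  {suc n} ne = refl
≢⇒≡ᵇ-false {suc m} {zero}  ne = refl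
≢⇒≡ᵇ-false {suc m} {suc n} ne = ≢⇒≡ᵇ-false (ne ∘ cong suc)

module Inflation (τ : List ℕ) (i j : ℕ) (φ ψ : List ℕ) where

  positions : List ℕ
  positions = map suc (upTo (length τ))

  block : ℕ → List ℕ
  block = blockAt i j φ ψ

  value : ℕ → ℕ
  value k = at τ (pred k)

  contribution : ℕ → ℕ → ℕ
  contribution k l = if value l <ᵇ value k then length (block l) else 0

  offset : ℕ → ℕ
  offset k = sum (map (contribution k) positions)

  entry : ℕ → List ℕ
  entry k = map (λ x → x + offset k) (block k)

  position : ∀ {k} → 1 ≤ k → k ≤ length τ → k ∈ positions
  position (s≤s z≤n) k≤n = ∈-map⁺ suc (∈-upTo⁺ k≤n)

  occurs-block : ∀ {k} → 1 ≤ k → k ≤ length τ → Occurs (block k) (inflate τ i j φ ψ)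
  occurs-block {k} 1≤k k≤n with ∈-∃++ (position 1≤k k≤n)
  ... | xs , ys , eq = concatMap entry xs , offset k , concatMap entry ys , (begin
    concatMap entry positions
      ≡⟨ cong (concatMap entry) eq ⟩
    concatMap entry (xs ++ k ∷ ys)
      ≡⟨ List.concatMap-++ entry xs (k ∷ ys) ⟩
    concatMap entry xs ++ entry k ++ concatMap entry ys
      ≡⟨ cong (λ z → concatMap entry xs ++ z ++ concatMap entry ys)
           (List.map-cong (λ x → ℕ.+-comm x (offset k)) (block k)) ⟩
    concatMap entry xs ++ map (offset k +_) (block k) ++ concatMap entry ys ∎)
    where open ≡-Reasoning

  block-first : block i ≡ φ
  block-first rewrite ≡ᵇ-refl i = refl

  block-second : i ≢ j → block j ≡ ψ
  -- `blockAt` tests `i` first, so position `j` receives ψ only because the indices differ.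
  block-second i≢j rewrite ≢⇒≡ᵇ-false (i≢j ∘ sym) | ≡ᵇ-refl j = refl

  block-elim : ∀ {P : List ℕ → Set} → P φ → P ψ → P (1 ∷ []) → ∀ k → P (block k)
  block-elim pφ pψ p1 k with k ≡ᵇ i | k ≡ᵇ j
  ... | true  | _     = pφ
  ... | false | true  = pψ
  ... | false | false = p1

  -- Whatever counts towards `offset k` counts towards `offset l`, and the block at `k` counts only
  -- towards the latter.
  offset-gap : ∀ {k l} → k ∈ positions → value k < value l → offset k + length (block k) ≤ offset l
  offset-gap {k} {l} k∈ lt = sum-map-gap positions mono gap k∈
    where
    mono : ∀ p → contribution k p ≤ contribution l p
    mono p with value p <ᵇ value k in eq
    ... | false = z≤n
    ... | true  rewrite <ᵇ-true (ℕ.<-trans (ℕ.<ᵇ⇒< (value p) _ (subst T (sym eq) _)) lt) = ℕ.≤-refl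
    gap : contribution k k + length (block k) ≤ contribution l k
    gap rewrite <ᵇ-irrefl (value k) | <ᵇ-true lt = ℕ.≤-refl

  -- Distinct positions of τ carry distinct values, and by `offset-gap` the block of the smaller
  -- value ends before that of the larger begins.
  inflate-unique : Unique τ → Unique φ → Unique ψ → Block φ → Block ψ → Unique (inflate τ i j φ ψ)
  inflate-unique uτ uφ uψ Bφ Bψ = Unique.concat⁺
    (All.map⁺ (All.universal (λ k → Unique.map⁺ (λ {x} {y} → ℕ.+-cancelʳ-≡ (offset k) x y)
                                       (block-elim uφ uψ ([] ∷ []) k)) positions))
    (AllPairs.map⁺ (AllPairs-map∈ disjoint
      (Unique.map⁺ ℕ.suc-injective (Unique.upTo⁺ (length τ)))))
    where
    in-block : ∀ k → All (InBlock (length (block k))) (block k)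
    in-block = block-elim {P = λ b → All (InBlock (length b)) b}
      (proj₁ Bφ) (proj₁ Bψ) ((ℕ.≤-refl , ℕ.≤-refl) ∷ [])
    separated : ∀ k l → k ∈ positions → value k < value l → Disjoint (entry k) (entry l)
    separated k l k∈ lt (v∈k , v∈l)
      with ∈-map⁻ (λ x → x + offset k) v∈k | ∈-map⁻ (λ x → x + offset l) v∈l
    ... | x , x∈ , refl | y , y∈ , eq = ℕ.<-irrefl eq (begin-strict
      x + offset k                  ≤⟨ ℕ.+-monoˡ-≤ (offset k) (proj₂ (All.lookup (in-block k) x∈)) ⟩
      length (block k) + offset k   ≡⟨ ℕ.+-comm _ (offset k) ⟩
      offset k + length (block k)   ≤⟨ offset-gap {k} {l} k∈ lt ⟩
      -- Strict because block values start at 1.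
      offset l                      <⟨ ℕ.+-monoˡ-≤ (offset l) (proj₁ (All.lookup (in-block l) y∈)) ⟩
      y + offset l                  ∎)
      where open ℕ.≤-Reasoning
    value-injective : ∀ {k l} → k ∈ positions → l ∈ positions → value k ≡ value l → k ≡ l
    value-injective k∈ l∈ eq with ∈-map⁻ suc k∈ | ∈-map⁻ suc l∈
    ... | p , p∈ , refl | q , q∈ , refl = cong suc (at-injective uτ (∈-upTo⁻ p∈) (∈-upTo⁻ q∈) eq)
    disjoint : ∀ {k l} → k ∈ positions → l ∈ positions → k ≢ l → Disjoint (entry k) (entry l)
    disjoint {k} {l} k∈ l∈ k≢l with ℕ.<-cmp (value k) (value l)
    ... | tri< lt _ _ = separated k l k∈ lt
    ... | tri≈ _ eq _ = contradiction (value-injective k∈ l∈ eq) k≢l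
    ... | tri> _ _ gt = separated l k l∈ gt ∘ swap

IsPerm⇒Unique : ∀ {τ} → IsPerm τ → Unique τ
IsPerm⇒Unique {τ} perm = Permutationₛ.Unique-resp-↭ (setoid ℕ) (↭⇒↭ₛ (↭-sym perm))
  (Unique.map⁺ ℕ.suc-injective (Unique.upTo⁺ (length τ)))

theorem6p2 : (τ : List ℕ) → IsPerm τ → (i j : ℕ) →
    1 ≤ i → i ≤ length τ → 1 ≤ j → j ≤ length τ → i ≢ j →
    μ[ 1 ∷ [] , inflate τ i j (2 ∷ 1 ∷ 4 ∷ 3 ∷ []) (2 ∷ 4 ∷ 3 ∷ 1 ∷ []) ] ≡ ℤ.pos 0
theorem6p2 τ perm i j 1≤i i≤n 1≤j j≤n i≢j = annihilates-2143-2431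
  (inflate-unique (IsPerm⇒Unique perm) (toWitness {a? = unique? p2143} _) (toWitness {a? = unique? p2431} _)
    (toWitness {a? = block? p2143} _) (toWitness {a? = block? p2431} _))
  (subst (λ b → Occurs b (inflate τ i j p2143 p2431)) block-first (occurs-block 1≤i i≤n))
  (subst (λ b → Occurs b (inflate τ i j p2143 p2431)) (block-second i≢j) (occurs-block 1≤j j≤n))
  where open Inflation τ i j p2143 p2431
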